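{- There are absolute positive constants $C_1,C_2$ such that the following holds. Let $t,d$ be positive integers with $t/30\ge d\ge\lfloor C_1\log t\rfloor$. Let $a_{i,1},a_{i,2}$, $1\le i\le d$, be $2d$ pairwise distinct elements of $\{1,2,\ldots,t\}$, chosen randomly with all choices of $d$ pairwise disjoint pairs being equally likely. Then, with probability at least $1-1/t^2$ (over the choice of the pairs), the chosen pairs have the following property: if for each $i$, $1\le i\le d$, an index $j_i\in\{1,2\}$ is chosen randomly, independently and uniformly, and $Q=\sum_{i=1}^d a_{i,j_i}$, then for every integer $S$ the probability (over the choice of the $j_i$) that $Q=S$ is at most $\frac{C_2}{t d^{1/2}}$. -}

module Defs where

open import Data.Fin.Base using (Fin)
open import Data.Integer.Base using (ℤ; +_; -1ℤ; ∣_∣)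
import Data.Integer.Properties as ℤ
open import Data.List.Base using (List; []; _∷_; [_]; length; filter; map; allFin; applyUpTo; cartesianProductWith)
open import Data.List.Membership.DecPropositional ℤ._≟_ using (_∈?_)
open import Data.List.Membership.Propositional using (_∈_)
open import Data.List.Membership.Propositional.Properties using (∈-map⁺)
open import Data.List.Properties using (filter-none)
import Data.List.Relation.Unary.All as All
open import Data.List.Relation.Unary.Any using (here; there)
open import Data.Nat.Base as ℕ using (ℕ; zero; suc; _^_)
import Data.Nat.DivMod as ℕ
open import Data.Nat.Logarithm using (⌊log₂_⌋)
import Data.Nat.Properties as ℕ
open import Data.Rational.Base using (ℚ; 0ℚ; _/_; _*_; _≤_; ↥_; ↧ₙ_)
open import Data.Rational.Properties using (_≤?_)
open import Data.Vec.Base as Vec using (Vec; lookup; zipWith; concat)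
open import Data.Vec.Relation.Unary.AllPairs using (allPairs?)
open import Data.Vec.Relation.Unary.Unique.Propositional using (Unique)
open import Level using (Level)
open import Relation.Binary.PropositionalEquality using (_≡_; refl; sym; trans; subst)
open import Relation.Nullary.Decidable using (yes; no; ¬?; map′)
open import Relation.Nullary.Negation using (¬_)
open import Relation.Unary using (Pred; Decidable)

private
  variable
    a p : Level
    A : Set a

-- The probability of P under the uniform distribution on the entries of a
-- list.  The empty list gets probability 0, so that a lower bound on a
-- probability is never vacuous.
Pr : {P : Pred A p} → List A → Decidable P → ℚ
Pr []        P? = 0ℚ
Pr Ω@(_ ∷ _) P? = + length (filter P? Ω) / length Ω

vectors : List A → (n : ℕ) → List (Vec A n)
vectors xs zero    = [ Vec.[] ]
vectors xs (suc n) = cartesianProductWith Vec._∷_ xs (vectors xs n)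

-- Row i of a matrix is the pair (a_{i,1} , a_{i,2}).
Pairs : ℕ → Set
Pairs d = Vec (Vec ℕ 2) d

-- All (a_{i,j}) whose 2d entries are pairwise distinct elements of {1,…,t}.
-- Each family of d disjoint unordered pairs is listed exactly d! 2^d times.
pairChoices : (t d : ℕ) → List (Pairs d)
pairChoices t d = filter distinct? (vectors (vectors (applyUpTo suc t) 2) d)
  where
  distinct? : Decidable (λ (as : Pairs d) → Unique (concat as))
  distinct? as = allPairs? (λ x y → ¬? (x ℕ.≟ y)) (concat as)

indexChoices : (d : ℕ) → List (Vec (Fin 2) d)
indexChoices d = vectors (allFin 2) d

Q : {d : ℕ} → Pairs d → Vec (Fin 2) d → ℕ
Q as js = Vec.sum (zipWith lookup as js)

Pr[Q_≡_] : {d : ℕ} → Pairs d → ℤ → ℚ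
Pr[Q_≡_] {d} as S = Pr (indexChoices d) (λ js → + Q as js ℤ.≟ S)

-- For C > 0, ⌊ (m/n) log₂ t ⌋ = ⌊ ⌊ log₂ (t^m) ⌋ / n ⌋ where C = m/n.
⌊_·log₂_⌋ : ℚ → ℕ → ℕ
⌊ C ·log₂ t ⌋ = ⌊log₂ t ^ ∣ ↥ C ∣ ⌋ ℕ./ ↧ₙ C

-- For x ≥ 0, C > 0 and t, d ≥ 1 this says x ≤ C / (t √d): both sides of
-- x t √d ≤ C are nonnegative and have been squared.
_≤_/[_√_] : ℚ → ℚ → ℕ → ℕ → Set
x ≤ C /[ t √ d ] = (x * (+ t / 1)) * (x * (+ t / 1)) * (+ d / 1) ≤ C * C

Spread : (C : ℚ) (t : ℕ) {d : ℕ} → Pairs d → Set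
Spread C t {d} as = (S : ℤ) → Pr[Q as ≡ S ] ≤ C /[ t √ d ]

-- Q takes finitely many values, and all S that are not values of Q have the
-- same probability as S = -1.
spread? : (C : ℚ) (t : ℕ) {d : ℕ} → Decidable (Spread C t {d})
spread? C t {d} as = map′ toSpread (λ h → All.tabulate (λ {S} _ → h S)) (All.all? bound? candidates)
  where
  value : Vec (Fin 2) d → ℤ
  value js = + Q as js

  values candidates : List ℤ
  values     = map value (indexChoices d)
  candidates = -1ℤ ∷ values

  Bound : ℤ → Set
  Bound S = Pr[Q as ≡ S ] ≤ C /[ t √ d ]

  bound? : Decidable Bound
  bound? S = _ ≤? _

  Pr-filter : {P R : Pred (Vec (Fin 2) d) _} (P? : Decidable P) (R? : Decidable R) (Ω : List (Vec (Fin 2) d)) →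
              filter P? Ω ≡ filter R? Ω → Pr Ω P? ≡ Pr Ω R?
  Pr-filter P? R? []      _  = refl
  Pr-filter P? R? (_ ∷ _) eq rewrite eq = refl

  none : (S : ℤ) → ¬ (S ∈ values) → filter (λ js → value js ℤ.≟ S) (indexChoices d) ≡ []
  none S S∉ = filter-none _ (All.tabulate (λ js∈ eq → S∉ (subst (_∈ values) eq (∈-map⁺ value js∈))))

  -1∉ : ¬ (-1ℤ ∈ values)
  -1∉ = go (indexChoices d)
    where
    go : (Ω : List (Vec (Fin 2) d)) → ¬ (-1ℤ ∈ map value Ω)
    go (_ ∷ Ω) (there i) = go Ω i

  toSpread : All.All Bound candidates → Spread C t as
  toSpread h S with S ∈? values
  ... | yes S∈ = All.lookup h (there S∈)
  ... | no  S∉ = subst (λ x → x ≤ C /[ t √ d ])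
                   (Pr-filter _ _ (indexChoices d) (trans (none -1ℤ -1∉) (sym (none S S∉))))
                   (All.lookup h (here refl))

{-# OPTIONS --safe #-}

-- Let F count the index choices of a partial sum by their value, let E = ‖F‖²
-- and D b = ‖F - F (· - b)‖².  Adding the pair (a₁ , a₂) replaces E by at most
-- 4 E - D ∣a₁ - a₂∣, so the normalised energy N = E / 4ᵏ drops unless ∣a₁ - a₂∣
-- is bad, i.e. D ∣a₁ - a₂∣ < E / m² for a suitable m ≈ 1 / (t N).  Few shifts are
-- bad: if M is the largest bad shift, then for bad b and j < m the numbers
-- b + j M are distinct, and √D is subadditive, so D (b + j M) < E and F
-- correlates with its translates by all of them; but these correlations add
-- up to at most (Σ F)² = 4ᵏ.  Hence each new pair is bad with small
-- probability whatever the past, and by an exponential moment all but a small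
-- fraction of the pairs are good with probability at least 1 - t⁻².  Every
-- good pair multiplies N by 3/4 while t N is large, and afterwards by
-- 1 - const · (t N)², which forces N = O(1 / (t √d)).  Finally, splitting the
-- pairs into two halves with counting functions G and H, Pr[Q = S] is a value
-- of G ∗ H / 2ᵈ, hence at most ‖G‖ ‖H‖ / 2ᵈ.

module Submission where

open import Defs
open import Data.Empty using (⊥-elim)
open import Data.Fin.Base using (Fin)
open import Data.List.Base as List using (List; []; _∷_; length; filter; applyUpTo; cartesianProductWith)
open import Data.List.Membership.DecPropositional using () renaming (_∈?_ to mem?)
open import Data.List.Membership.Propositional using (_∉_)
open import Data.List.Properties using (filter-none)
import Data.List.Relation.Unary.All as ListAll
open import Data.List.Relation.Unary.Any using (here; there)
open import Data.Nat.Base as ℕ using (ℕ; zero; suc; _+_; _*_; _∸_; _^_; _/_; _%_; _≤_; _<_; z≤n; s≤s; ∣_-_∣; _⊔_; NonZero; ≢-nonZero; >-nonZero)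
open import Data.Nat.DivMod using (m/n*n≤m; m<n⇒m/n≡0; m/n≤m; m≡m%n+[m/n]*n; m%n<n; n/1≡n)
open import Data.Nat.Logarithm using (⌊log₂_⌋; ⌊log₂⌋-mono-≤; ⌊log₂[2^n]⌋≡n)
open import Data.Nat.Properties
open import Data.Nat.Tactic.RingSolver using (solve-∀)
open import Data.Product.Base using (_,_; _×_; proj₁; proj₂; ∃-syntax)
open import Data.Sum.Base using (_⊎_; inj₁; inj₂; [_,_]′)
open import Data.Vec.Base using (Vec; []; _∷_; concat)
open import Data.Vec.Relation.Unary.All as All using (All; []; _∷_)
open import Data.Vec.Relation.Unary.AllPairs using ([]; _∷_; allPairs?)
open import Data.Vec.Relation.Unary.Unique.Propositional using (Unique)
open import Function.Base using (_∘_)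
open import Relation.Binary.PropositionalEquality using (_≡_; _≢_; refl; sym; trans; cong; cong₂; subst; subst₂; module ≡-Reasoning)
open import Relation.Nullary.Decidable using (Dec; yes; no; ¬?)
open import Relation.Nullary.Negation using (¬_)
open import Relation.Unary using (Pred; Decidable)

-- Sums and translates

Σ< : ℕ → (ℕ → ℕ) → ℕ
Σ< zero    f = 0
Σ< (suc n) f = f 0 + Σ< n (f ∘ suc)

Σ<-mono-≤ : ∀ n {f g} → (∀ i → i < n → f i ≤ g i) → Σ< n f ≤ Σ< n g
Σ<-mono-≤ zero    h = z≤n
Σ<-mono-≤ (suc n) h = +-mono-≤ (h 0 (s≤s z≤n)) (Σ<-mono-≤ n (λ i i<n → h (suc i) (s≤s i<n)))

Σ<-cong : ∀ n {f g} → (∀ i → f i ≡ g i) → Σ< n f ≡ Σ< n g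
Σ<-cong zero    h = refl
Σ<-cong (suc n) h = cong₂ _+_ (h 0) (Σ<-cong n (h ∘ suc))

Σ<-distrib-+ : ∀ n f g → Σ< n (λ i → f i + g i) ≡ Σ< n f + Σ< n g
Σ<-distrib-+ zero    f g = refl
Σ<-distrib-+ (suc n) f g rewrite Σ<-distrib-+ n (f ∘ suc) (g ∘ suc) = lemma (f 0) (g 0) _ _
  where
  lemma : ∀ a b c d → a + b + (c + d) ≡ a + c + (b + d)
  lemma = solve-∀

*-distribˡ-Σ< : ∀ n c f → c * Σ< n f ≡ Σ< n (λ i → c * f i)
*-distribˡ-Σ< zero    c f = *-zeroʳ c
*-distribˡ-Σ< (suc n) c f = trans (*-distribˡ-+ c (f 0) _) (cong (c * f 0 +_) (*-distribˡ-Σ< n c (f ∘ suc)))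

Σ<-const : ∀ n c → Σ< n (λ _ → c) ≡ n * c
Σ<-const zero    c = refl
Σ<-const (suc n) c = cong (c +_) (Σ<-const n c)

Σ<-snoc : ∀ n f → Σ< (suc n) f ≡ Σ< n f + f n
Σ<-snoc zero    f = +-comm (f 0) 0
Σ<-snoc (suc n) f = trans (cong (f 0 +_) (Σ<-snoc n (f ∘ suc))) (sym (+-assoc (f 0) _ _))

Σ<-split : ∀ m n f → Σ< (m + n) f ≡ Σ< m f + Σ< n (λ i → f (m + i))
Σ<-split zero    n f = refl
Σ<-split (suc m) n f = trans (cong (f 0 +_) (Σ<-split m n (f ∘ suc))) (sym (+-assoc (f 0) _ _))

Σ<-blocks : ∀ m n f → Σ< (m * n) f ≡ Σ< m (λ j → Σ< n (λ i → f (j * n + i)))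
Σ<-blocks zero    n f = refl
Σ<-blocks (suc m) n f = trans (Σ<-split n (m * n) f) (cong (Σ< n f +_)
  (trans (Σ<-blocks m n (λ i → f (n + i)))
         (Σ<-cong m (λ j → Σ<-cong n (λ i → cong f (sym (+-assoc n (j * n) i)))))))

Σ<-swap : ∀ m n (f : ℕ → ℕ → ℕ) → Σ< m (λ i → Σ< n (f i)) ≡ Σ< n (λ j → Σ< m (λ i → f i j))
Σ<-swap zero    n f = sym (trans (Σ<-const n 0) (*-zeroʳ n))
Σ<-swap (suc m) n f = trans (cong (Σ< n (f 0) +_) (Σ<-swap m n (f ∘ suc)))
  (sym (Σ<-distrib-+ n (f 0) (λ j → Σ< m (λ i → f (suc i) j))))

Σ<-monoˡ-≤ : ∀ {m n} f → m ≤ n → Σ< m f ≤ Σ< n f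
Σ<-monoˡ-≤ f z≤n       = z≤n
Σ<-monoˡ-≤ f (s≤s m≤n) = +-monoʳ-≤ (f 0) (Σ<-monoˡ-≤ (f ∘ suc) m≤n)

SupportedBelow : ℕ → (ℕ → ℕ) → Set
SupportedBelow K f = ∀ x → K ≤ x → f x ≡ 0

Σ<-supported : ∀ {K} n f → SupportedBelow K f → Σ< n f ≤ Σ< K f
Σ<-supported         zero    f supp = z≤n
Σ<-supported {zero}  (suc n) f supp rewrite supp 0 z≤n = Σ<-supported {zero} n (f ∘ suc) (λ x _ → supp (suc x) z≤n)
Σ<-supported {suc K} (suc n) f supp = +-monoʳ-≤ (f 0) (Σ<-supported n (f ∘ suc) (λ x K≤x → supp (suc x) (s≤s K≤x)))

-- shift s F x = F (x - s), with F extended by 0 to negative arguments.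
shift : ℕ → (ℕ → ℕ) → ℕ → ℕ
shift zero    F x       = F x
shift (suc s) F zero    = 0
shift (suc s) F (suc x) = shift s F x

shift-cong : ∀ s {F G} → (∀ x → F x ≡ G x) → ∀ x → shift s F x ≡ shift s G x
shift-cong zero    h x       = h x
shift-cong (suc s) h zero    = refl
shift-cong (suc s) h (suc x) = shift-cong s h x

shift-shift : ∀ a b F x → shift a (shift b F) x ≡ shift (a + b) F x
shift-shift zero    b F x       = refl
shift-shift (suc a) b F zero    = refl
shift-shift (suc a) b F (suc x) = shift-shift a b F x

-- The condition on `φ 0 0` makes the zeros padded in by `shift` agree on both sides. It covers
-- products, sums and squared differences.
shift-zipWith : ∀ (φ : ℕ → ℕ → ℕ) → φ 0 0 ≡ 0 → ∀ s F G x →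
                shift s (λ x → φ (F x) (G x)) x ≡ φ (shift s F x) (shift s G x)
shift-zipWith φ φ0 zero    F G x       = refl
shift-zipWith φ φ0 (suc s) F G zero    = sym φ0
shift-zipWith φ φ0 (suc s) F G (suc x) = shift-zipWith φ φ0 s F G x

shift-supported : ∀ {K} s {F} → SupportedBelow K F → SupportedBelow (s + K) (shift s F)
shift-supported zero    supp x       K≤x       = supp x K≤x
shift-supported (suc s) supp (suc x) (s≤s s≤x) = shift-supported s supp x s≤x

Σ<-shift : ∀ s n F → Σ< (s + n) (shift s F) ≡ Σ< n F
Σ<-shift zero    n F = refl
Σ<-shift (suc s) n F = Σ<-shift s n F

Σ<-shift-≤ : ∀ s n F → Σ< n (shift s F) ≤ Σ< n F
Σ<-shift-≤ zero    n       F = ≤-refl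
Σ<-shift-≤ (suc s) zero    F = z≤n
Σ<-shift-≤ (suc s) (suc n) F = ≤-trans (Σ<-shift-≤ s n F) (Σ<-monoˡ-≤ F (n≤1+n n))

-- As `s` grows, `shift s F x` runs through `F x`, `F (x - 1)`, ..., `F 0` and then vanishes, so no
-- value of `F` is met twice.
Σ<-shifts-≤ : ∀ n x F → Σ< n (λ s → shift s F x) ≤ Σ< (suc x) F
Σ<-shifts-≤ zero    x       F = z≤n
Σ<-shifts-≤ (suc n) zero    F = +-monoʳ-≤ (F 0) (≤-reflexive (trans (Σ<-const n 0) (*-zeroʳ n)))
Σ<-shifts-≤ (suc n) (suc x) F = begin
  F (suc x) + Σ< n (λ s → shift s F x) ≤⟨ +-monoʳ-≤ (F (suc x)) (Σ<-shifts-≤ n x F) ⟩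
  F (suc x) + Σ< (suc x) F             ≡⟨ +-comm (F (suc x)) _ ⟩
  Σ< (suc x) F + F (suc x)             ≡⟨ Σ<-snoc (suc x) F ⟨
  Σ< (suc (suc x)) F                   ∎
  where open ≤-Reasoning

∣m-n∣²+2mn≡m²+n² : ∀ m n → ∣ m - n ∣ * ∣ m - n ∣ + 2 * (m * n) ≡ m * m + n * n
∣m-n∣²+2mn≡m²+n² zero    n       = +-identityʳ (n * n)
∣m-n∣²+2mn≡m²+n² (suc m) zero    rewrite *-zeroʳ m = refl
∣m-n∣²+2mn≡m²+n² (suc m) (suc n) = trans (lemma₁ ∣ m - n ∣ m n)
  (trans (cong (_+ (2 + 2 * m + 2 * n)) (∣m-n∣²+2mn≡m²+n² m n)) (lemma₂ m n))
  where
  lemma₁ : ∀ d m n → d * d + 2 * (suc m * suc n) ≡ d * d + 2 * (m * n) + (2 + 2 * m + 2 * n)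
  lemma₁ = solve-∀
  lemma₂ : ∀ m n → m * m + n * n + (2 + 2 * m + 2 * n) ≡ suc m * suc m + suc n * suc n
  lemma₂ = solve-∀

2mn≤m²+n² : ∀ m n → 2 * (m * n) ≤ m * m + n * n
2mn≤m²+n² m n = subst (2 * (m * n) ≤_) (∣m-n∣²+2mn≡m²+n² m n) (m≤n+m (2 * (m * n)) (∣ m - n ∣ * ∣ m - n ∣))

-- With weights j and 1 this is the convexity of squaring: it lets the
-- distances D (b + j M) grow only quadratically in j.
weighted-triangle : ∀ j a b c → j * (∣ a - c ∣ * ∣ a - c ∣) ≤
  (1 + j) * (∣ a - b ∣ * ∣ a - b ∣) + j * (1 + j) * (∣ b - c ∣ * ∣ b - c ∣)
weighted-triangle j a b c = begin
  j * (∣ a - c ∣ * ∣ a - c ∣)             ≤⟨ *-monoʳ-≤ j (*-mono-≤ tri tri) ⟩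
  j * ((u + v) * (u + v))                 ≡⟨ lemma₁ j u v ⟩
  j * (u * u + v * v) + 2 * (u * (j * v)) ≤⟨ +-monoʳ-≤ (j * (u * u + v * v)) (2mn≤m²+n² u (j * v)) ⟩
  j * (u * u + v * v) + (u * u + j * v * (j * v)) ≡⟨ lemma₂ j u v ⟩
  (1 + j) * (u * u) + j * (1 + j) * (v * v) ∎
  where
  open ≤-Reasoning
  u v : ℕ
  u = ∣ a - b ∣
  v = ∣ b - c ∣
  tri : ∣ a - c ∣ ≤ u + v
  tri = ∣-∣-triangle a b c
  lemma₁ : ∀ j u v → j * ((u + v) * (u + v)) ≡ j * (u * u + v * v) + 2 * (u * (j * v))
  lemma₁ = solve-∀
  lemma₂ : ∀ j u v → j * (u * u + v * v) + (u * u + j * v * (j * v)) ≡ (1 + j) * (u * u) + j * (1 + j) * (v * v)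
  lemma₂ = solve-∀

-- The energy of a counting function

𝟙 : ∀ {p} {P : Set p} → Dec P → ℕ
𝟙 (yes _) = 1
𝟙 (no  _) = 0

sq : ℕ → ℕ
sq m = m * m

addPair : ℕ → ℕ → (ℕ → ℕ) → ℕ → ℕ
addPair a₁ a₂ F x = shift a₁ F x + shift a₂ F x

module Energy (W : ℕ) where

  -- ‖F‖², the autocorrelation ⟨F , F (· - s)⟩ and ‖F - F (· - s)‖², truncated at W.
  E : (ℕ → ℕ) → ℕ
  E F = Σ< W (λ x → sq (F x))

  R D : (ℕ → ℕ) → ℕ → ℕ
  R F s = Σ< W (λ x → F x * shift s F x)
  D F s = Σ< W (λ x → sq ∣ F x - shift s F x ∣)

  E-shift-≤ : ∀ s F → E (shift s F) ≤ E F
  E-shift-≤ s F = subst (_≤ E F) (Σ<-cong W (shift-zipWith _*_ refl s F F)) (Σ<-shift-≤ s W (λ x → F x * F x))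

  D+2R≡ : ∀ F s → D F s + 2 * R F s ≡ E F + E (shift s F)
  D+2R≡ F s = trans (cong (D F s +_) (*-distribˡ-Σ< W 2 (λ x → F x * shift s F x)))
    (trans (sym (Σ<-distrib-+ W (λ x → sq ∣ F x - shift s F x ∣) (λ x → 2 * (F x * shift s F x))))
    (trans (Σ<-cong W (λ x → ∣m-n∣²+2mn≡m²+n² (F x) (shift s F x)))
           (Σ<-distrib-+ W (λ x → sq (F x)) (λ x → sq (shift s F x)))))

  D+2R≤2E : ∀ F s → D F s + 2 * R F s ≤ 2 * E F
  D+2R≤2E F s = subst₂ _≤_ (sym (D+2R≡ F s)) (cong (E F +_) (sym (+-identityʳ (E F)))) (+-monoʳ-≤ (E F) (E-shift-≤ s F))

  -- The converse of `D+2R≤2E` asks the window to contain the translated support, so that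
  -- `shift s F` keeps the full energy of `F`.
  2E≤D+2R : ∀ {K} F s → SupportedBelow K F → K + s ≤ W → 2 * E F ≤ D F s + 2 * R F s
  2E≤D+2R {K} F s supp K+s≤W = subst₂ _≤_ (cong (E F +_) (sym (+-identityʳ (E F)))) (sym (D+2R≡ F s)) (+-monoʳ-≤ (E F) (begin
    Σ< W (λ x → sq (F x))                   ≤⟨ Σ<-supported W _ (λ x K≤x → cong sq (supp x K≤x)) ⟩
    Σ< K (λ x → sq (F x))                   ≡⟨ Σ<-shift s K (λ x → sq (F x)) ⟨
    Σ< (s + K) (shift s (λ x → sq (F x)))   ≤⟨ Σ<-monoˡ-≤ _ (subst (_≤ W) (+-comm K s) K+s≤W) ⟩
    Σ< W (shift s (λ x → sq (F x)))         ≡⟨ Σ<-cong W (shift-zipWith _*_ refl s F F) ⟩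
    E (shift s F)                           ∎))
    where open ≤-Reasoning

  D-triangle : ∀ F j s M → j * D F (s + M) ≤ (1 + j) * D F s + j * (1 + j) * D F M
  D-triangle F j s M = begin
    j * D F (s + M)
      ≡⟨ *-distribˡ-Σ< W j _ ⟩
    Σ< W (λ x → j * sq ∣ F x - shift (s + M) F x ∣)
      ≤⟨ Σ<-mono-≤ W (λ x _ → weighted-triangle j (F x) (shift s F x) (shift (s + M) F x)) ⟩
    Σ< W (λ x → (1 + j) * sq ∣ F x - shift s F x ∣ + j * (1 + j) * sq ∣ shift s F x - shift (s + M) F x ∣)
      ≡⟨ Σ<-distrib-+ W (λ x → (1 + j) * sq ∣ F x - shift s F x ∣) _ ⟩
    Σ< W (λ x → (1 + j) * sq ∣ F x - shift s F x ∣) + Σ< W (λ x → j * (1 + j) * sq ∣ shift s F x - shift (s + M) F x ∣)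
      ≡⟨ cong₂ _+_ (*-distribˡ-Σ< W (1 + j) _) (*-distribˡ-Σ< W (j * (1 + j)) _) ⟨
    (1 + j) * D F s + j * (1 + j) * Σ< W (λ x → sq ∣ shift s F x - shift (s + M) F x ∣)
      ≤⟨ +-monoʳ-≤ ((1 + j) * D F s) (*-monoʳ-≤ (j * (1 + j)) translated) ⟩
    (1 + j) * D F s + j * (1 + j) * D F M
      ∎
    where
    open ≤-Reasoning
    translated : Σ< W (λ x → sq ∣ shift s F x - shift (s + M) F x ∣) ≤ D F M
    translated = begin
      Σ< W (λ x → sq ∣ shift s F x - shift (s + M) F x ∣)
        ≡⟨ Σ<-cong W (λ x → cong (λ z → sq ∣ shift s F x - z ∣) (shift-shift s M F x)) ⟨
      Σ< W (λ x → sq ∣ shift s F x - shift s (shift M F) x ∣)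
        ≡⟨ Σ<-cong W (shift-zipWith (λ m n → sq ∣ m - n ∣) refl s F (shift M F)) ⟨
      Σ< W (shift s (λ x → sq ∣ F x - shift M F x ∣))
        ≤⟨ Σ<-shift-≤ s W _ ⟩
      D F M
        ∎

  -- Subadditivity of `√D` suggests `√D (b + j M) ≤ (1 + j) √δ`. The weighted triangle inequality
  -- gives the squared form without square roots: with weight `suc j` its two terms add up exactly
  -- to the next bound.
  D-progression : ∀ F b M {δ} → D F b ≤ δ → D F M ≤ δ → ∀ j → D F (b + j * M) ≤ sq (1 + j) * δ
  D-progression F b M {δ} hb hM zero    = subst₂ _≤_ (cong (D F) (sym (+-identityʳ b))) (sym (+-identityʳ δ)) hb
  D-progression F b M {δ} hb hM (suc j) = *-cancelˡ-≤ (suc j) (begin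
    suc j * D F (b + suc j * M)
      ≡⟨ cong (λ s → suc j * D F s) (trans (cong (b +_) (+-comm M (j * M))) (sym (+-assoc b (j * M) M))) ⟩
    suc j * D F (b + j * M + M)
      ≤⟨ D-triangle F (suc j) (b + j * M) M ⟩
    (2 + j) * D F (b + j * M) + suc j * (2 + j) * D F M
      ≤⟨ +-mono-≤ (*-monoʳ-≤ (2 + j) (D-progression F b M hb hM j)) (*-monoʳ-≤ (suc j * (2 + j)) hM) ⟩
    (2 + j) * (sq (1 + j) * δ) + suc j * (2 + j) * δ
      ≡⟨ lemma j δ ⟩
    suc j * (sq (2 + j) * δ)
      ∎)
    where
    open ≤-Reasoning
    lemma : ∀ j δ → (2 + j) * ((1 + j) * (1 + j) * δ) + (1 + j) * (2 + j) * δ ≡ (1 + j) * ((2 + j) * (2 + j) * δ)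
    lemma = solve-∀

  -- For distinct positive shifts `s` the products `F x * F (x - s)` are distinct terms in the
  -- expansion of `sq (Σ< W F)`.
  ΣR≤ : ∀ F n → Σ< n (R F ∘ suc) ≤ sq (Σ< W F)
  ΣR≤ F n = begin
    Σ< n (λ s → Σ< W (λ x → F x * shift (suc s) F x)) ≡⟨ Σ<-swap n W _ ⟩
    Σ< W (λ x → Σ< n (λ s → F x * shift (suc s) F x)) ≡⟨ Σ<-cong W (λ x → *-distribˡ-Σ< n (F x) _) ⟨
    Σ< W (λ x → F x * Σ< n (λ s → shift (suc s) F x)) ≤⟨ Σ<-mono-≤ W (λ x x<W → *-monoʳ-≤ (F x) (bound x x<W)) ⟩
    Σ< W (λ x → F x * Σ< W F)                         ≡⟨ Σ<-cong W (λ x → *-comm (F x) _) ⟩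
    Σ< W (λ x → Σ< W F * F x)                         ≡⟨ *-distribˡ-Σ< W (Σ< W F) F ⟨
    sq (Σ< W F)                                       ∎
    where
    open ≤-Reasoning
    bound : ∀ x → x < W → Σ< n (λ s → shift (suc s) F x) ≤ Σ< W F
    bound x x<W = ≤-trans (m≤n+m _ (F x)) (≤-trans (Σ<-shifts-≤ (suc n) x F) (Σ<-monoˡ-≤ F x<W))

  bad? : ∀ m F b → Dec (D F b * sq m < E F)
  bad? m F b = D F b * sq m <? E F

  -- If M is the largest bad shift, then the numbers b + j M with b bad and
  -- j < m are distinct, and F is correlated with each of these translates.
  bad-shifts : ∀ {K} m F t → SupportedBelow K F → K + m * t ≤ W →
               E F * (m * Σ< t (λ i → 𝟙 (bad? m F (suc i)))) ≤ 2 * sq (Σ< W F)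
  bad-shifts m F zero supp K≤W rewrite *-zeroʳ m | *-zeroʳ (E F) = z≤n
  -- Induction on `t` finds the largest bad shift: if `suc t` is not bad it is dropped, otherwise it
  -- is `M`.
  bad-shifts {K} m F (suc t) supp K≤W rewrite Σ<-snoc t (λ i → 𝟙 (bad? m F (suc i))) with bad? m F (suc t) in eq
  ... | no  _    rewrite +-identityʳ (Σ< t (λ i → 𝟙 (bad? m F (suc i)))) =
    bad-shifts m F t supp (≤-trans (+-monoʳ-≤ K (*-monoʳ-≤ m (n≤1+n t))) K≤W)
  ... | yes badM = begin
    E F * (m * (Σ< t χ + 1))
      ≡⟨ cong (λ z → E F * (m * (Σ< t χ + 𝟙 z))) eq ⟨
    E F * (m * (Σ< t χ + χ t))
      ≡⟨ cong (λ z → E F * (m * z)) (Σ<-snoc t χ) ⟨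
    E F * (m * Σ< M χ)
      ≡⟨ cong (E F *_) (Σ<-const m (Σ< M χ)) ⟨
    E F * Σ< m (λ _ → Σ< M χ)
      ≡⟨ *-distribˡ-Σ< m (E F) _ ⟩
    Σ< m (λ _ → E F * Σ< M χ)
      ≡⟨ Σ<-cong m (λ _ → *-distribˡ-Σ< M (E F) χ) ⟩
    Σ< m (λ _ → Σ< M (λ i → E F * χ i))
      ≤⟨ Σ<-mono-≤ m (λ j j<m → Σ<-mono-≤ M (λ i i<M → correlated j i j<m i<M)) ⟩
    Σ< m (λ j → Σ< M (λ i → 2 * R F (suc (j * M + i))))
      -- Division by `M` with remainder: the pairs `(j , i)` enumerate the shifts 1, ..., `m * M`
      -- once each, so the translates are distinct.
      ≡⟨ Σ<-blocks m M (λ s → 2 * R F (suc s)) ⟨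
    Σ< (m * M) (λ s → 2 * R F (suc s))
      ≡⟨ *-distribˡ-Σ< (m * M) 2 (R F ∘ suc) ⟨
    2 * Σ< (m * M) (R F ∘ suc)
      ≤⟨ *-monoʳ-≤ 2 (ΣR≤ F (m * M)) ⟩
    2 * sq (Σ< W F)
      ∎
    where
    open ≤-Reasoning
    M : ℕ
    M = suc t
    χ : ℕ → ℕ
    χ i = 𝟙 (bad? m F (suc i))
    correlated : ∀ j i → j < m → i < M → E F * χ i ≤ 2 * R F (suc (j * M + i))
    correlated j i j<m i<M with bad? m F (suc i)
    ... | no  _    rewrite *-zeroʳ (E F) = z≤n
    ... | yes badb rewrite *-identityʳ (E F) | +-comm (j * M) i = +-cancelˡ-≤ (E F) _ _ (begin
      E F + E F                            ≡⟨ cong (E F +_) (+-identityʳ (E F)) ⟨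
      2 * E F                              ≤⟨ 2E≤D+2R F s supp (≤-trans (+-monoʳ-≤ K s≤) K≤W) ⟩
      D F s + 2 * R F s                    ≤⟨ +-monoˡ-≤ (2 * R F s) Ds≤ ⟩
      E F + 2 * R F s                      ∎)
      where
      s δ : ℕ
      s = suc i + j * M
      -- Both shifts are bad, so the larger of their distances still satisfies the strict bound and
      -- can serve for both in `D-progression`.
      δ = D F (suc i) ⊔ D F M
      s≤ : s ≤ m * M
      s≤ = ≤-trans (+-monoˡ-≤ (j * M) i<M) (*-monoˡ-≤ M j<m)
      δ< : δ * sq m < E F
      δ< with ⊔-sel (D F (suc i)) (D F M)
      ... | inj₁ p rewrite p = badb
      ... | inj₂ p rewrite p = badM
      Ds≤ : D F s ≤ E F
      Ds≤ = begin
        D F s            ≤⟨ D-progression F (suc i) M (m≤m⊔n _ _) (m≤n⊔m (D F (suc i)) _) j ⟩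
        sq (1 + j) * δ   ≤⟨ *-monoˡ-≤ δ (*-mono-≤ j<m j<m) ⟩
        sq m * δ         ≡⟨ *-comm (sq m) δ ⟩
        δ * sq m         <⟨ δ< ⟩
        E F              ∎

  private
    -- Expanding the square leaves at most `2 E` from the two translates and `2 R` from the cross
    -- term; `D+2R≤2E` trades the correlation for the distance.
    E-addPair-ordered : ∀ F a b → E (addPair a (a + b) F) + D F b ≤ 4 * E F
    E-addPair-ordered F a b = begin
      E (addPair a (a + b) F) + D F b
        ≡⟨ cong (_+ D F b) expand ⟩
      E p + E q + 2 * Σ< W (λ x → p x * q x) + D F b
        ≤⟨ +-monoˡ-≤ (D F b) (+-mono-≤ (+-mono-≤ (E-shift-≤ a F) (E-shift-≤ (a + b) F)) (*-monoʳ-≤ 2 cross)) ⟩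
      E F + E F + 2 * R F b + D F b
        ≡⟨ lemma₁ (E F) (R F b) (D F b) ⟩
      2 * E F + (D F b + 2 * R F b)
        ≤⟨ +-monoʳ-≤ (2 * E F) (D+2R≤2E F b) ⟩
      2 * E F + 2 * E F
        ≡⟨ lemma₂ (E F) ⟩
      4 * E F
        ∎
      where
      open ≤-Reasoning
      p q : ℕ → ℕ
      p = shift a F
      q = shift (a + b) F
      lemma₁ : ∀ e r d → e + e + 2 * r + d ≡ 2 * e + (d + 2 * r)
      lemma₁ = solve-∀
      lemma₂ : ∀ e → 2 * e + 2 * e ≡ 4 * e
      lemma₂ = solve-∀
      lemma₃ : ∀ p q → (p + q) * (p + q) ≡ p * p + q * q + 2 * (p * q)
      lemma₃ = solve-∀
      expand : E (addPair a (a + b) F) ≡ E p + E q + 2 * Σ< W (λ x → p x * q x)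
      expand = trans (Σ<-cong W (λ x → lemma₃ (p x) (q x)))
        (trans (Σ<-distrib-+ W (λ x → sq (p x) + sq (q x)) _)
               (cong₂ _+_ (Σ<-distrib-+ W (λ x → sq (p x)) _) (sym (*-distribˡ-Σ< W 2 _))))
      cross : Σ< W (λ x → p x * q x) ≤ R F b
      cross = begin
        Σ< W (λ x → p x * q x)                    ≡⟨ Σ<-cong W (λ x → cong (p x *_) (shift-shift a b F x)) ⟨
        Σ< W (λ x → p x * shift a (shift b F) x)  ≡⟨ Σ<-cong W (shift-zipWith _*_ refl a F (shift b F)) ⟨
        Σ< W (shift a (λ x → F x * shift b F x))  ≤⟨ Σ<-shift-≤ a W _ ⟩
        R F b                                     ∎

  E-addPair : ∀ F a₁ a₂ → E (addPair a₁ a₂ F) + D F ∣ a₁ - a₂ ∣ ≤ 4 * E F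
  E-addPair F a₁ a₂ with ≤-total a₁ a₂
  ... | inj₁ a₁≤a₂ = subst₂ (λ a b → E (addPair a₁ a F) + D F b ≤ 4 * E F)
    (m+[n∸m]≡n a₁≤a₂) (sym (m≤n⇒∣m-n∣≡n∸m a₁≤a₂)) (E-addPair-ordered F a₁ (a₂ ∸ a₁))
  ... | inj₂ a₂≤a₁ = subst (λ e → e + D F ∣ a₁ - a₂ ∣ ≤ 4 * E F) (Σ<-cong W (λ x → cong sq (+-comm (shift a₂ F x) _)))
    (subst₂ (λ a b → E (addPair a₂ a F) + D F b ≤ 4 * E F)
      (m+[n∸m]≡n a₂≤a₁) (sym (m≤n⇒∣n-m∣≡n∸m a₂≤a₁)) (E-addPair-ordered F a₂ (a₁ ∸ a₂)))

  Σ<-addPair-≤ : ∀ F a₁ a₂ → Σ< W (addPair a₁ a₂ F) ≤ 2 * Σ< W F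
  Σ<-addPair-≤ F a₁ a₂ = subst₂ _≤_ (sym (Σ<-distrib-+ W (shift a₁ F) (shift a₂ F)))
    (cong (Σ< W F +_) (sym (+-identityʳ (Σ< W F)))) (+-mono-≤ (Σ<-shift-≤ a₁ W F) (Σ<-shift-≤ a₂ W F))

-- Convolutions and the energy recursion

conv : (ℕ → ℕ) → (ℕ → ℕ) → ℕ → ℕ
conv G H zero    = G 0 * H 0
conv G H (suc S) = G 0 * H (suc S) + conv (G ∘ suc) H S

-- Splitting off the last term instead of the first is the defining recursion with the roles of `G`
-- and `H` exchanged, hence `conv-comm`.
conv-snoc : ∀ G H S → conv G H (suc S) ≡ conv G (H ∘ suc) S + G (suc S) * H 0
conv-snoc G H zero    = refl
conv-snoc G H (suc S) = trans (cong (G 0 * H (2 + S) +_) (conv-snoc (G ∘ suc) H S)) (sym (+-assoc (G 0 * H (2 + S)) _ _))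

conv-comm : ∀ G H S → conv G H S ≡ conv H G S
conv-comm G H zero    = *-comm (G 0) (H 0)
conv-comm G H (suc S) = trans (conv-snoc G H S)
  (trans (cong₂ _+_ (conv-comm G (H ∘ suc) S) (*-comm (G (suc S)) (H 0))) (+-comm _ (H 0 * G (suc S))))

conv-shiftˡ : ∀ a G H S → conv (shift a G) H S ≡ shift a (conv G H) S
conv-shiftˡ zero    G H S       = refl
conv-shiftˡ (suc a) G H zero    = refl
conv-shiftˡ (suc a) G H (suc S) = conv-shiftˡ a G H S

conv-distribʳ-+ : ∀ G G′ H S → conv (λ x → G x + G′ x) H S ≡ conv G H S + conv G′ H S
conv-distribʳ-+ G G′ H zero    = *-distribʳ-+ (H 0) (G 0) (G′ 0)
conv-distribʳ-+ G G′ H (suc S) = trans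
  (cong₂ _+_ (*-distribʳ-+ (H (suc S)) (G 0) (G′ 0)) (conv-distribʳ-+ (G ∘ suc) (G′ ∘ suc) H S))
  (lemma (G 0 * H (suc S)) (G′ 0 * H (suc S)) (conv (G ∘ suc) H S) (conv (G′ ∘ suc) H S))
  where
  lemma : ∀ a b c d → a + b + (c + d) ≡ a + c + (b + d)
  lemma = solve-∀

conv-addPairˡ : ∀ a₁ a₂ G H S → conv (addPair a₁ a₂ G) H S ≡ addPair a₁ a₂ (conv G H) S
conv-addPairˡ a₁ a₂ G H S = trans (conv-distribʳ-+ (shift a₁ G) (shift a₂ G) H S)
  (cong₂ _+_ (conv-shiftˡ a₁ G H S) (conv-shiftˡ a₂ G H S))

-- Cauchy-Schwarz without square roots: each product `G i * H (S - i)` is bounded through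
-- `2 u v ≤ u² + v²` with `u = α G i` and `v = β H (S - i)`. The free weights let the two energies
-- be balanced later.
conv-AM-GM : ∀ α β G H S → 2 * (α * β) * conv G H S ≤
             sq α * Σ< (suc S) (sq ∘ G) + sq β * Σ< (suc S) (sq ∘ H)
conv-AM-GM α β G H zero    = begin
  2 * (α * β) * (G 0 * H 0)                         ≡⟨ lemma₁ α β (G 0) (H 0) ⟩
  2 * (α * G 0 * (β * H 0))                         ≤⟨ 2mn≤m²+n² (α * G 0) (β * H 0) ⟩
  sq (α * G 0) + sq (β * H 0)                       ≡⟨ lemma₂ α β (G 0) (H 0) ⟩
  sq α * (sq (G 0) + 0) + sq β * (sq (H 0) + 0)     ∎
  where
  open ≤-Reasoning
  lemma₁ : ∀ α β g h → 2 * (α * β) * (g * h) ≡ 2 * (α * g * (β * h))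
  lemma₁ = solve-∀
  lemma₂ : ∀ α β g h → α * g * (α * g) + β * h * (β * h) ≡ α * α * (g * g + 0) + β * β * (h * h + 0)
  lemma₂ = solve-∀
conv-AM-GM α β G H (suc S) = begin
  2 * (α * β) * (G 0 * h + c)
    ≡⟨ lemma₁ α β (G 0) h c ⟩
  2 * (α * G 0 * (β * h)) + 2 * (α * β) * c
    ≤⟨ +-mono-≤ (2mn≤m²+n² (α * G 0) (β * h)) (conv-AM-GM α β (G ∘ suc) H S) ⟩
  sq (α * G 0) + sq (β * h) + (sq α * Σ< (suc S) (sq ∘ G ∘ suc) + sq β * Σ< (suc S) (sq ∘ H))
    ≡⟨ lemma₂ α β (G 0) h (Σ< (suc S) (sq ∘ G ∘ suc)) (Σ< (suc S) (sq ∘ H)) ⟩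
  sq α * (sq (G 0) + Σ< (suc S) (sq ∘ G ∘ suc)) + sq β * (Σ< (suc S) (sq ∘ H) + sq h)
    ≡⟨ cong (λ z → sq α * (sq (G 0) + Σ< (suc S) (sq ∘ G ∘ suc)) + sq β * z) (Σ<-snoc (suc S) (sq ∘ H)) ⟨
  sq α * Σ< (2 + S) (sq ∘ G) + sq β * Σ< (2 + S) (sq ∘ H)
    ∎
  where
  open ≤-Reasoning
  h c : ℕ
  h = H (suc S)
  c = conv (G ∘ suc) H S
  lemma₁ : ∀ α β g h c → 2 * (α * β) * (g * h + c) ≡ 2 * (α * g * (β * h)) + 2 * (α * β) * c
  lemma₁ = solve-∀
  lemma₂ : ∀ α β g h x y → α * g * (α * g) + β * h * (β * h) + (α * α * x + β * β * y) ≡ α * α * (g * g + x) + β * β * (y + h * h)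
  lemma₂ = solve-∀

-- The counting function of the empty sum, which is the unit of convolution.
δ₀ : ℕ → ℕ
δ₀ zero    = 1
δ₀ (suc _) = 0

conv-δ₀ : ∀ S → conv δ₀ δ₀ S ≡ δ₀ S
conv-δ₀ zero    = refl
conv-δ₀ (suc S) = vanish S
  where
  vanish : ∀ S → conv (λ _ → 0) δ₀ S ≡ 0
  vanish zero    = refl
  vanish (suc S) = vanish S

-- The logistic step: if z ≤ 1/s then z (1 - z) ≤ 1/(s + 1), here with z = y / (y + c).
logistic : ∀ s y c → s * y ≤ y + c → suc s * (y * c) ≤ sq (y + c)
logistic s y c sy≤Z with ≤-total (suc s * y) (y + c)
... | inj₁ le = subst (_≤ sq (y + c)) (*-assoc (suc s) y c) (*-mono-≤ le (m≤n+m c y))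
-- In this case `suc s * c ≤ s * (y + c)`, and the hypothesis bounds the remaining factor `s * y`.
... | inj₂ ge = begin
  suc s * (y * c)     ≡⟨ lemma₁ s y c ⟩
  y * (suc s * c)     ≤⟨ *-monoʳ-≤ y (+-cancelˡ-≤ (y + c) _ _ (begin
    y + c + suc s * c       ≤⟨ +-monoˡ-≤ (suc s * c) ge ⟩
    suc s * y + suc s * c   ≡⟨ *-distribˡ-+ (suc s) y c ⟨
    suc s * (y + c)         ∎)) ⟩
  y * (s * (y + c))   ≡⟨ lemma₂ s y c ⟩
  s * y * (y + c)     ≤⟨ *-monoˡ-≤ (y + c) sy≤Z ⟩
  sq (y + c)          ∎
  where
  open ≤-Reasoning
  lemma₁ : ∀ s y c → suc s * (y * c) ≡ y * (suc s * c)
  lemma₁ = solve-∀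
  lemma₂ : ∀ s y c → y * (s * (y + c)) ≡ s * y * (y + c)
  lemma₂ = solve-∀

-- The number m of the argument for bad shifts when ‖F‖² = e and p = 4ᵏ: just
-- large enough that e m l ≤ 2 p forces q l ≤ t.
reach : (q t p e : ℕ) → ℕ
reach q t p e = suc (2 * q * p / suc (e * t))

-- While the normalised energy exceeds `2 q / t`, a good pair is one with `D ≥ E`, which is what
-- lowers `4 E` to `3 E`.
reach-large : ∀ q t p e → 2 * q * p < e * t → reach q t p e ≡ 1
reach-large q t p e lt = cong suc (m<n⇒m/n≡0 (m<n⇒m<1+n lt))

reach-small : ∀ q t p e → e * t ≤ 2 * q * p → reach q t p e * (e * t) ≤ 4 * q * p
reach-small q t p e le = begin
  e * t + 2 * q * p / suc (e * t) * (e * t)      ≤⟨ +-mono-≤ le (*-monoʳ-≤ (2 * q * p / suc (e * t)) (n≤1+n (e * t))) ⟩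
  2 * q * p + 2 * q * p / suc (e * t) * suc (e * t) ≤⟨ +-monoʳ-≤ (2 * q * p) (m/n*n≤m (2 * q * p) (suc (e * t))) ⟩
  2 * q * p + 2 * q * p                            ≡⟨ lemma q p ⟩
  4 * q * p                                        ∎
  where
  open ≤-Reasoning
  lemma : ∀ q p → 2 * q * p + 2 * q * p ≡ 4 * q * p
  lemma = solve-∀

-- Put `z = (e t)² / (8 q p)²`. The bounds `m e t ≤ 4 q p` and `e ≤ δ m²` force `δ ≥ 4 e z`, so
-- `e′ ≤ 4 e (1 - z)`. Using this for one factor of `e′²` and `e′ ≤ 4 e` for the other, the new `z`
-- is at most `z (1 - z)`, and `logistic` applies.
energy-decay : ∀ q t p {e e′ δ} m s .{{_ : NonZero q}} .{{p≢0 : NonZero p}} →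
               e * t ≤ 2 * q * p → m * (e * t) ≤ 4 * q * p → e ≤ δ * sq m → e′ + δ ≤ 4 * e →
               sq (e * t) * s ≤ sq (8 * q * p) → sq (e′ * t) * suc s ≤ sq (8 * q * (4 * p))
energy-decay q t p {e} {e′} {δ} m s et≤ met≤ e≤ e′≤ ys≤ = *-cancelˡ-≤ Z {{Z≢0}} (begin
  Z * (sq (e′ * t) * suc s)             ≡⟨ lemma₁ Z e′ t (suc s) ⟩
  suc s * (Z * e′ * (e′ * sq t))        ≤⟨ *-monoʳ-≤ (suc s) (*-mono-≤ Ze′≤ (*-monoˡ-≤ (sq t) (m+n≤o⇒m≤o e′ e′≤))) ⟩
  suc s * (4 * (e * c) * (4 * e * sq t)) ≡⟨ lemma₂ (suc s) e c t ⟩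
  16 * (suc s * (y * c))                ≤⟨ *-monoʳ-≤ 16 (logistic s y c sy≤) ⟩
  16 * sq (y + c)                       ≡⟨ cong (λ z → 16 * sq z) y+c≡Z ⟩
  16 * sq Z                             ≡⟨ lemma₃ q p ⟩
  Z * sq (8 * q * (4 * p))              ∎)
  where
  open ≤-Reasoning
  y Z c : ℕ
  y = sq (e * t)
  Z = sq (8 * q * p)
  c = Z ∸ y
  Z≢0 : NonZero Z
  Z≢0 = m*n≢0 (8 * q * p) (8 * q * p) {{8qp≢0}} {{8qp≢0}}
    where
    8qp≢0 : NonZero (8 * q * p)
    8qp≢0 = m*n≢0 (8 * q) p {{m*n≢0 8 q}}
  2qp≤ : 2 * q * p ≤ 8 * q * p
  2qp≤ = *-monoˡ-≤ p (*-monoˡ-≤ q (m≤m+n 2 6))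
  y+c≡Z : y + c ≡ Z
  y+c≡Z = m+[n∸m]≡n (*-mono-≤ (≤-trans et≤ 2qp≤) (≤-trans et≤ 2qp≤))
  sy≤ : s * y ≤ y + c
  sy≤ = subst₂ _≤_ (*-comm y s) (sym y+c≡Z) ys≤
  lemma₁ : ∀ Z e t s → Z * (e * t * (e * t) * s) ≡ s * (Z * e * (e * (t * t)))
  lemma₁ = solve-∀
  lemma₂ : ∀ s e c t → s * (4 * (e * c) * (4 * e * (t * t))) ≡ 16 * (s * (e * t * (e * t) * c))
  lemma₂ = solve-∀
  lemma₃ : ∀ q p → 16 * (8 * q * p * (8 * q * p) * (8 * q * p * (8 * q * p))) ≡ 8 * q * p * (8 * q * p) * (8 * q * (4 * p) * (8 * q * (4 * p)))
  lemma₃ = solve-∀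
  lemma₄ : ∀ δ m x → 4 * (δ * (m * m) * (x * x)) ≡ 4 * (δ * (m * x * (m * x)))
  lemma₄ = solve-∀
  lemma₅ : ∀ δ q p → 4 * (δ * (4 * q * p * (4 * q * p))) ≡ 8 * q * p * (8 * q * p) * δ
  lemma₅ = solve-∀
  lemma₆ : ∀ Z e → Z * (4 * e) ≡ 4 * (e * Z)
  lemma₆ = solve-∀
  lemma₇ : ∀ e y c → 4 * (e * (y + c)) ≡ 4 * (e * y) + 4 * (e * c)
  lemma₇ = solve-∀
  4ey≤Zδ : 4 * (e * y) ≤ Z * δ
  4ey≤Zδ = begin
    4 * (e * y)                          ≤⟨ *-monoʳ-≤ 4 (*-monoˡ-≤ y e≤) ⟩
    4 * (δ * sq m * y)                   ≡⟨ lemma₄ δ m (e * t) ⟩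
    4 * (δ * sq (m * (e * t)))           ≤⟨ *-monoʳ-≤ 4 (*-monoʳ-≤ δ (*-mono-≤ met≤ met≤)) ⟩
    4 * (δ * sq (4 * q * p))             ≡⟨ lemma₅ δ q p ⟩
    Z * δ                                ∎
  Ze′≤ : Z * e′ ≤ 4 * (e * c)
  Ze′≤ = +-cancelˡ-≤ (4 * (e * y)) _ _ (begin
    4 * (e * y) + Z * e′       ≤⟨ +-monoˡ-≤ (Z * e′) 4ey≤Zδ ⟩
    Z * δ + Z * e′             ≡⟨ *-distribˡ-+ Z δ e′ ⟨
    Z * (δ + e′)               ≡⟨ cong (Z *_) (+-comm δ e′) ⟩
    Z * (e′ + δ)               ≤⟨ *-monoʳ-≤ Z e′≤ ⟩
    Z * (4 * e)                ≡⟨ lemma₆ Z e ⟩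
    4 * (e * Z)                ≡⟨ cong (λ z → 4 * (e * z)) y+c≡Z ⟨
    4 * (e * (y + c))          ≡⟨ lemma₇ e y c ⟩
    4 * (e * y) + 4 * (e * c)  ∎)

-- Adding one pair

4^n≡sq[2^n] : ∀ n → 4 ^ n ≡ sq (2 ^ n)
4^n≡sq[2^n] zero    = refl
4^n≡sq[2^n] (suc n) = trans (cong (4 *_) (4^n≡sq[2^n] n)) (lemma (2 ^ n))
  where
  lemma : ∀ p → 4 * (p * p) ≡ 2 * p * (2 * p)
  lemma = solve-∀

-- A node is a partial sum under construction: F x counts the index choices
-- with partial sum x, and good and bad count the pairs used so far.
record Node : Set where
  constructor node
  field
    good bad : ℕ
    F        : ℕ → ℕ

  steps : ℕ
  steps = good + bad

open Node

root : Node
root = node 0 0 δ₀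

-- `1 / q` is the proportion of bad shifts allowed, and `r₁` good steps end the phase of large
-- energy, because `(3/4) ^ r₁ ≤ 1 / t`.
module Process (t q W r₁ : ℕ) .{{_ : NonZero q}} (3ʳt≤4ʳ : 3 ^ r₁ * t ≤ 4 ^ r₁) where

  open Energy W

  multiplier : Node → ℕ
  multiplier N = reach q t (4 ^ steps N) (E (F N))

  badPair? : ∀ N a₁ a₂ → Dec (D (F N) ∣ a₁ - a₂ ∣ * sq (multiplier N) < E (F N))
  badPair? N a₁ a₂ = bad? (multiplier N) (F N) ∣ a₁ - a₂ ∣

  extend : ℕ → ℕ → Node → Node
  extend a₁ a₂ N = node ((1 ∸ 𝟙 (badPair? N a₁ a₂)) + good N) (𝟙 (badPair? N a₁ a₂) + bad N) (addPair a₁ a₂ (F N))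

  steps-extend : ∀ a₁ a₂ N → steps (extend a₁ a₂ N) ≡ suc (steps N)
  steps-extend a₁ a₂ N with badPair? N a₁ a₂
  ... | yes _ = +-suc (good N) (bad N)
  ... | no  _ = refl

  -- For the normalised energy `x = E / 4 ^ steps`, `decay` says `x ≤ (3/4) ^ good` or `t x ≤ 2 q`;
  -- the latter persists, as `x` never increases. `energy` is the square of
  -- `t x ≤ 8 q / √(good - r₁)`; by truncated subtraction it takes effect only after `r₁` good
  -- steps.
  record Inv (N : Node) : Set where
    field
      mass      : Σ< W (F N) ≤ 2 ^ steps N
      supported : SupportedBelow (suc (steps N * t)) (F N)
      decay     : E (F N) ≤ 4 ^ bad N * 3 ^ good N ⊎ E (F N) * t ≤ 2 * q * 4 ^ steps N
      energy    : sq (E (F N) * t) * (good N ∸ r₁) ≤ sq (8 * q * 4 ^ steps N)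

  Inv-root : Inv root
  Inv-root = record
    { mass      = Σδ₀≤1 W
    ; supported = λ { (suc x) _ → refl }
    ; decay     = inj₁ (≤-trans (≤-reflexive (Σ<-cong W sqδ₀)) (Σδ₀≤1 W))
    ; energy    = subst (_≤ sq (8 * q * 1)) (sym (trans (cong (sq (E δ₀ * t) *_) (0∸n≡0 r₁)) (*-zeroʳ (sq (E δ₀ * t))))) z≤n
    }
    where
    sqδ₀ : ∀ x → sq (δ₀ x) ≡ δ₀ x
    sqδ₀ zero    = refl
    sqδ₀ (suc _) = refl
    Σδ₀≤1 : ∀ n → Σ< n δ₀ ≤ 1
    Σδ₀≤1 zero    = z≤n
    Σδ₀≤1 (suc n) = ≤-reflexive (cong suc (trans (Σ<-const n 0) (*-zeroʳ n)))

  -- In the first alternative of `decay`, `r₁` of the factors `3/4` absorb `t`, and the others are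
  -- at most 1.
  decayed : ∀ {N} → Inv N → r₁ ≤ good N → E (F N) * t ≤ 2 * q * 4 ^ steps N
  decayed {N} inv r₁≤r with Inv.decay inv
  ... | inj₂ le = le
  ... | inj₁ le = begin
    E (F N) * t                             ≤⟨ *-monoˡ-≤ t le ⟩
    4 ^ x * 3 ^ r * t                       ≡⟨ cong (λ z → 4 ^ x * 3 ^ z * t) (m∸n+n≡m r₁≤r) ⟨
    4 ^ x * 3 ^ (r ∸ r₁ + r₁) * t           ≡⟨ cong (λ z → 4 ^ x * z * t) (^-distribˡ-+-* 3 (r ∸ r₁) r₁) ⟩
    4 ^ x * (3 ^ (r ∸ r₁) * 3 ^ r₁) * t     ≡⟨ lemma (4 ^ x) (3 ^ (r ∸ r₁)) (3 ^ r₁) t ⟩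
    3 ^ (r ∸ r₁) * (3 ^ r₁ * t) * 4 ^ x     ≤⟨ *-monoˡ-≤ (4 ^ x) (*-mono-≤ (^-monoˡ-≤ (r ∸ r₁) (n≤1+n 3)) 3ʳt≤4ʳ) ⟩
    4 ^ (r ∸ r₁) * 4 ^ r₁ * 4 ^ x           ≡⟨ cong (_* 4 ^ x) (^-distribˡ-+-* 4 (r ∸ r₁) r₁) ⟨
    4 ^ (r ∸ r₁ + r₁) * 4 ^ x               ≡⟨ cong (λ z → 4 ^ z * 4 ^ x) (m∸n+n≡m r₁≤r) ⟩
    4 ^ r * 4 ^ x                           ≡⟨ ^-distribˡ-+-* 4 r x ⟨
    4 ^ (r + x)                             ≤⟨ m≤n*m (4 ^ (r + x)) (2 * q) {{m*n≢0 2 q}} ⟩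
    2 * q * 4 ^ (r + x)                     ∎
    where
    open ≤-Reasoning
    r x : ℕ
    r = good N
    x = bad N
    lemma : ∀ a b c t → a * (b * c) * t ≡ b * (c * t) * a
    lemma = solve-∀

  energy-small : ∀ {N} → Inv N → ∀ s → s + r₁ ≤ good N → sq (E (F N) * t) * s ≤ sq (8 * q * 4 ^ steps N)
  energy-small {N} inv s s+r₁≤ = ≤-trans (*-monoʳ-≤ (sq (E (F N) * t)) (m+n≤o⇒m≤o∸n s s+r₁≤)) (Inv.energy inv)

  private
    16Z : ∀ q p → 16 * sq (8 * q * p) ≡ sq (8 * q * (4 * p))
    16Z q p = lemma q p
      where
      lemma : ∀ q p → 16 * (8 * q * p * (8 * q * p)) ≡ 8 * q * (4 * p) * (8 * q * (4 * p))
      lemma = solve-∀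

    4[2qp] : ∀ q p → 4 * (2 * q * p) ≡ 2 * q * (4 * p)
    4[2qp] = solve-∀

    quadruple : ∀ {e e′} p → e′ ≤ 4 * e → e * t ≤ 2 * q * p → e′ * t ≤ 2 * q * (4 * p)
    quadruple {e} {e′} p e′≤ et≤ = begin
      e′ * t          ≤⟨ *-monoˡ-≤ t e′≤ ⟩
      4 * e * t       ≡⟨ *-assoc 4 e t ⟩
      4 * (e * t)     ≤⟨ *-monoʳ-≤ 4 et≤ ⟩
      4 * (2 * q * p) ≡⟨ 4[2qp] q p ⟩
      2 * q * (4 * p) ∎
      where open ≤-Reasoning

  Inv-extend : ∀ {a₁ a₂ N} → a₁ ≤ t → a₂ ≤ t → Inv N → Inv (extend a₁ a₂ N)
  Inv-extend {a₁} {a₂} {N} a₁≤t a₂≤t inv = record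
    { mass      = subst (λ k → Σ< W G ≤ 2 ^ k) (sym k′≡) (≤-trans (Σ<-addPair-≤ (F N) a₁ a₂) (*-monoʳ-≤ 2 (Inv.mass inv)))
    ; supported = subst (λ k → SupportedBelow (suc (k * t)) G) (sym k′≡) λ x le →
                    cong₂ _+_ (shift-supported a₁ (Inv.supported inv) x (≤-trans (grow a₁≤t) le))
                              (shift-supported a₂ (Inv.supported inv) x (≤-trans (grow a₂≤t) le))
    ; decay     = proof-decay
    ; energy    = subst (λ k → sq (e′ * t) * (good N′ ∸ r₁) ≤ sq (8 * q * 4 ^ k)) (sym k′≡) proof-energy
    }
    where
    open ≤-Reasoning
    N′ : Node
    N′ = extend a₁ a₂ N
    G : ℕ → ℕ
    G = F N′
    k e e′ δ : ℕ
    k = steps N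
    e = E (F N)
    e′ = E G
    δ = D (F N) ∣ a₁ - a₂ ∣
    k′≡ : steps N′ ≡ suc k
    k′≡ = steps-extend a₁ a₂ N
    grow : ∀ {a} → a ≤ t → a + suc (k * t) ≤ suc (suc k * t)
    grow {a} a≤t = ≤-trans (≤-reflexive (+-suc a (k * t))) (s≤s (+-monoˡ-≤ (k * t) a≤t))
    e′+δ≤4e : e′ + δ ≤ 4 * e
    e′+δ≤4e = E-addPair (F N) a₁ a₂
    e′≤4e : e′ ≤ 4 * e
    e′≤4e = m+n≤o⇒m≤o e′ e′+δ≤4e

    lemma₁ : ∀ x y → 4 * (x * y) ≡ 4 * x * y
    lemma₁ = solve-∀
    lemma₂ : ∀ x y → 3 * (x * y) ≡ x * (3 * y)
    lemma₂ = solve-∀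
    lemma₃ : ∀ e t s → 4 * e * t * (4 * e * t) * s ≡ 16 * (e * t * (e * t) * s)
    lemma₃ = solve-∀

    drop : 2 * q * 4 ^ k < e * t → e ≤ δ * sq (multiplier N) → e′ ≤ 3 * e
    drop large e≤ = +-cancelʳ-≤ e e′ (3 * e) (begin
      e′ + e          ≤⟨ +-monoʳ-≤ e′ e≤ ⟩
      e′ + δ * sq (multiplier N) ≡⟨ cong (λ m → e′ + δ * sq m) (reach-large q t (4 ^ k) e large) ⟩
      e′ + δ * 1      ≡⟨ cong (e′ +_) (*-identityʳ δ) ⟩
      e′ + δ          ≤⟨ e′+δ≤4e ⟩
      4 * e           ≡⟨ +-comm e (3 * e) ⟩
      3 * e + e       ∎)

    proof-decay : e′ ≤ 4 ^ bad N′ * 3 ^ good N′ ⊎ e′ * t ≤ 2 * q * 4 ^ steps N′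
    proof-decay with ≤-<-connex (e * t) (2 * q * 4 ^ k)
    ... | inj₁ small = inj₂ (subst (λ k → e′ * t ≤ 2 * q * 4 ^ k) (sym k′≡) (quadruple {e} (4 ^ k) e′≤4e small))
    ... | inj₂ large with Inv.decay inv
    ...   | inj₂ small = ⊥-elim (<⇒≱ large small)
    ...   | inj₁ e≤ with badPair? N a₁ a₂
    ...     | yes _    = inj₁ (≤-trans e′≤4e (≤-trans (*-monoʳ-≤ 4 e≤) (≤-reflexive (lemma₁ (4 ^ bad N) (3 ^ good N)))))
    ...     | no ¬bad  = inj₁ (≤-trans (drop large (≮⇒≥ ¬bad)) (≤-trans (*-monoʳ-≤ 3 e≤) (≤-reflexive (lemma₂ (4 ^ bad N) (3 ^ good N)))))

    proof-energy : sq (e′ * t) * (good N′ ∸ r₁) ≤ sq (8 * q * 4 ^ suc k)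
    proof-energy with badPair? N a₁ a₂
    -- A bad pair multiplies the energy by at most 4, which the step from `4 ^ k` to `4 ^ suc k`
    -- absorbs; `good` stays the same.
    ... | yes _    = begin
      sq (e′ * t) * (good N ∸ r₁)        ≤⟨ *-monoˡ-≤ (good N ∸ r₁) (*-mono-≤ (*-monoˡ-≤ t e′≤4e) (*-monoˡ-≤ t e′≤4e)) ⟩
      sq (4 * e * t) * (good N ∸ r₁)     ≡⟨ lemma₃ e t (good N ∸ r₁) ⟩
      16 * (sq (e * t) * (good N ∸ r₁))  ≤⟨ *-monoʳ-≤ 16 (Inv.energy inv) ⟩
      16 * sq (8 * q * 4 ^ k)            ≡⟨ 16Z q (4 ^ k) ⟩
      sq (8 * q * 4 ^ suc k)             ∎
    ... | no ¬bad with ≤-<-connex r₁ (good N)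
    ...   | inj₂ r<r₁ = subst (_≤ sq (8 * q * 4 ^ suc k))
      (sym (trans (cong (sq (e′ * t) *_) (m≤n⇒m∸n≡0 r<r₁)) (*-zeroʳ (sq (e′ * t))))) z≤n
    ...   | inj₁ r₁≤r = subst (λ s → sq (e′ * t) * s ≤ sq (8 * q * 4 ^ suc k)) (sym (+-∸-assoc 1 r₁≤r))
      (energy-decay q t (4 ^ k) {e} {e′} {δ} (multiplier N) (good N ∸ r₁) {{p≢0 = m^n≢0 4 k}} small
        (reach-small q t (4 ^ k) e small) (≮⇒≥ ¬bad) e′+δ≤4e (Inv.energy inv))
      where
      small : e * t ≤ 2 * q * 4 ^ k
      small = decayed inv r₁≤r

  multiplier≤ : ∀ N → multiplier N ≤ suc (2 * q * 4 ^ steps N)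
  multiplier≤ N = s≤s (m/n≤m _ (suc (E (F N) * t)))

  -- For `L` bad shifts, `bad-shifts` and the mass bound give `e m L ≤ 2 * 4 ^ steps`. Division with
  -- remainder in `reach` gives `2 q * 4 ^ steps < m (e t + 1)`. Together, `e q L ≤ e t`.
  few-bad-shifts : ∀ {N} → Inv N → suc (steps N * t) + multiplier N * t ≤ W →
                   q * Σ< t (λ i → 𝟙 (bad? (multiplier N) (F N) (suc i))) ≤ t
  few-bad-shifts {N} inv fits with E (F N) ≟ 0
  ... | yes e≡0 = subst (λ l → q * l ≤ t) (sym (n≤0⇒n≡0 none)) (subst (_≤ t) (sym (*-zeroʳ q)) z≤n)
    where
    none : Σ< t (λ i → 𝟙 (bad? (multiplier N) (F N) (suc i))) ≤ 0
    none = ≤-trans (Σ<-mono-≤ t {g = λ _ → 0} λ i _ → not-bad i) (≤-reflexive (trans (Σ<-const t 0) (*-zeroʳ t)))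
      where
      not-bad : ∀ i → 𝟙 (bad? (multiplier N) (F N) (suc i)) ≤ 0
      not-bad i with bad? (multiplier N) (F N) (suc i)
      ... | yes lt = ⊥-elim (n≮0 (≤-trans lt (≤-reflexive e≡0)))
      ... | no  _  = z≤n
  ... | no  e≢0 = *-cancelˡ-≤ e {{≢-nonZero e≢0}} (≤-pred (*-cancelˡ-< m (e * (q * L)) (suc (e * t)) (begin-strict
    m * (e * (q * L))             ≡⟨ lemma₁ m e q L ⟩
    q * (e * (m * L))             ≤⟨ *-monoʳ-≤ q (bad-shifts m (F N) t (Inv.supported inv) fits) ⟩
    q * (2 * sq (Σ< W (F N)))     ≤⟨ *-monoʳ-≤ q (*-monoʳ-≤ 2 (*-mono-≤ (Inv.mass inv) (Inv.mass inv))) ⟩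
    q * (2 * sq (2 ^ steps N))    ≡⟨ cong (λ z → q * (2 * z)) (4^n≡sq[2^n] (steps N)) ⟨
    q * (2 * 4 ^ steps N)         ≡⟨ lemma₂ q (4 ^ steps N) ⟩
    n                             ≡⟨ m≡m%n+[m/n]*n n (suc (e * t)) ⟩
    n % suc (e * t) + n / suc (e * t) * suc (e * t) <⟨ +-monoˡ-< _ (m%n<n n (suc (e * t))) ⟩
    m * suc (e * t)               ∎)))
    where
    open ≤-Reasoning
    e m n L : ℕ
    e = E (F N)
    m = multiplier N
    n = 2 * q * 4 ^ steps N
    L = Σ< t (λ i → 𝟙 (bad? (multiplier N) (F N) (suc i)))
    lemma₁ : ∀ m e q L → m * (e * (q * L)) ≡ q * (e * (m * L))
    lemma₁ = solve-∀
    lemma₂ : ∀ q p → q * (2 * p) ≡ 2 * q * p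
    lemma₂ = solve-∀

-- Drawing disjoint pairs

𝟙-mono : ∀ {p} {P : Set p} (P? : Dec P) {m n} → (P → m ≤ n) → 𝟙 P? * m ≤ 𝟙 P? * n
𝟙-mono (yes p) m≤n = *-monoʳ-≤ 1 (m≤n p)
𝟙-mono (no _)  m≤n = z≤n

𝟙-cong : ∀ {p q} {P : Set p} {Q : Set q} (P? : Dec P) (Q? : Dec Q) → (P → Q) → (Q → P) → 𝟙 P? ≡ 𝟙 Q?
𝟙-cong (yes p) (yes q) f g = refl
𝟙-cong (yes p) (no ¬q) f g = ⊥-elim (¬q (f p))
𝟙-cong (no ¬p) (yes q) f g = ⊥-elim (¬p (g q))
𝟙-cong (no ¬p) (no ¬q) f g = refl

∑ : ∀ {a} {A : Set a} → List A → (A → ℕ) → ℕ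
∑ []       f = 0
∑ (x ∷ xs) f = f x + ∑ xs f

module _ {a} {A : Set a} where

  ∑-cong : ∀ (xs : List A) {f g} → (∀ x → f x ≡ g x) → ∑ xs f ≡ ∑ xs g
  ∑-cong []       h = refl
  ∑-cong (x ∷ xs) h = cong₂ _+_ (h x) (∑-cong xs h)

  ∑-distrib-+ : ∀ (xs : List A) f g → ∑ xs (λ x → f x + g x) ≡ ∑ xs f + ∑ xs g
  ∑-distrib-+ []       f g = refl
  ∑-distrib-+ (x ∷ xs) f g rewrite ∑-distrib-+ xs f g = lemma (f x) (g x) (∑ xs f) (∑ xs g)
    where
    lemma : ∀ a b c d → a + b + (c + d) ≡ a + c + (b + d)
    lemma = solve-∀

  *-distribˡ-∑ : ∀ (xs : List A) c f → c * ∑ xs f ≡ ∑ xs (λ x → c * f x)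
  *-distribˡ-∑ []       c f = *-zeroʳ c
  *-distribˡ-∑ (x ∷ xs) c f = trans (*-distribˡ-+ c (f x) _) (cong (c * f x +_) (*-distribˡ-∑ xs c f))

  ∑-++ : ∀ (xs ys : List A) f → ∑ (xs List.++ ys) f ≡ ∑ xs f + ∑ ys f
  ∑-++ []       ys f = refl
  ∑-++ (x ∷ xs) ys f = trans (cong (f x +_) (∑-++ xs ys f)) (sym (+-assoc (f x) _ _))

  ∑-map : ∀ {b} {B : Set b} (xs : List B) (h : B → A) f → ∑ (List.map h xs) f ≡ ∑ xs (f ∘ h)
  ∑-map []       h f = refl
  ∑-map (x ∷ xs) h f = cong (f (h x) +_) (∑-map xs h f)

  ∑-applyUpTo : ∀ (h : ℕ → A) n f → ∑ (applyUpTo h n) f ≡ Σ< n (f ∘ h)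
  ∑-applyUpTo h zero    f = refl
  ∑-applyUpTo h (suc n) f = cong (f (h 0) +_) (∑-applyUpTo (h ∘ suc) n f)

  ∑-cartesianProductWith : ∀ {b c} {B : Set b} {C : Set c} (_⊗_ : B → C → A) xs ys f →
    ∑ (cartesianProductWith _⊗_ xs ys) f ≡ ∑ xs (λ x → ∑ ys (λ y → f (x ⊗ y)))
  ∑-cartesianProductWith _⊗_ []       ys f = refl
  ∑-cartesianProductWith _⊗_ (x ∷ xs) ys f = trans (∑-++ (List.map (x ⊗_) ys) _ f)
    (cong₂ _+_ (∑-map ys (x ⊗_) f) (∑-cartesianProductWith _⊗_ xs ys f))

  ∑-filter : ∀ {p} {P : Pred A p} (P? : Decidable P) xs f → ∑ (filter P? xs) f ≡ ∑ xs (λ x → 𝟙 (P? x) * f x)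
  ∑-filter P? []       f = refl
  ∑-filter P? (x ∷ xs) f with P? x
  ... | yes _ = cong₂ _+_ (sym (+-identityʳ (f x))) (∑-filter P? xs f)
  ... | no  _ = ∑-filter P? xs f

  length≡∑ : ∀ (xs : List A) → length xs ≡ ∑ xs (λ _ → 1)
  length≡∑ []       = refl
  length≡∑ (x ∷ xs) = cong suc (length≡∑ xs)

fresh? : ∀ x U → Dec (x ∉ U)
fresh? x U = ¬? (mem? _≟_ x U)

-- The indicator that the entries are distinct and avoid `U`, as a product over the entries, so that
-- sums over vectors can be evaluated one entry at a time.
fresh : ∀ {n} → List ℕ → Vec ℕ n → ℕ
fresh U []      = 1
fresh U (x ∷ v) = 𝟙 (fresh? x U) * fresh (x ∷ U) v

fresh-spec : ∀ {n} U (v : Vec ℕ n) →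
  (fresh U v ≡ 0 × ¬ (All (_∉ U) v × Unique v)) ⊎ (fresh U v ≡ 1 × All (_∉ U) v × Unique v)
fresh-spec U []      = inj₂ (refl , [] , [])
fresh-spec U (x ∷ v) with fresh? x U
... | no ¬x∉U = inj₁ (refl , λ { (x∉U ∷ _ , _) → ¬x∉U x∉U })
... | yes x∉U with fresh-spec (x ∷ U) v
...   | inj₁ (≡0 , ¬fr) = inj₁ (trans (+-identityʳ _) ≡0 , λ { (_ ∷ v∉U , x≢v ∷ uv) → ¬fr (avoid v∉U x≢v , uv) })
  where
  avoid : ∀ {n} {v : Vec ℕ n} → All (_∉ U) v → All (x ≢_) v → All (_∉ x ∷ U) v
  avoid []          []          = []
  avoid (y∉U ∷ v∉U) (x≢y ∷ x≢v) = (λ { (here y≡x) → x≢y (sym y≡x) ; (there y∈U) → y∉U y∈U }) ∷ avoid v∉U x≢v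
...   | inj₂ (≡1 , v∉ , uv) = inj₂ (trans (+-identityʳ _) ≡1 ,
  x∉U ∷ All.map (λ y∉ y∈U → y∉ (there y∈U)) v∉ , All.map (λ y∉ x≡y → y∉ (here (sym x≡y))) v∉ ∷ uv)

distinct? : ∀ {n} (v : Vec ℕ n) → Dec (Unique v)
distinct? v = allPairs? (λ x y → ¬? (x ≟ y)) v

𝟙-distinct : ∀ {n} (v : Vec ℕ n) → 𝟙 (distinct? v) ≡ fresh [] v
𝟙-distinct v with fresh-spec [] v | distinct? v
... | inj₁ (≡0 , ¬fr)    | yes u = ⊥-elim (¬fr (All.universal (λ _ ()) v , u))
... | inj₁ (≡0 , ¬fr)    | no  _ = sym ≡0
... | inj₂ (≡1 , _ , _)  | yes _ = sym ≡1
... | inj₂ (≡1 , _ , u)  | no ¬u = ⊥-elim (¬u u)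

pairVectors : (t d : ℕ) → List (Pairs d)
pairVectors t d = vectors (vectors (applyUpTo suc t) 2) d

∑-pairChoices : ∀ t d f → ∑ (pairChoices t d) f ≡ ∑ (pairVectors t d) (λ as → fresh [] (concat as) * f as)
∑-pairChoices t d f = trans (∑-filter (λ as → distinct? (concat as)) (pairVectors t d) f)
  (∑-cong (pairVectors t d) (λ as → cong (_* f as) (𝟙-distinct (concat as))))

∑-pairVectors-suc : ∀ t d f → ∑ (pairVectors t (suc d)) f ≡
  Σ< t (λ i → Σ< t (λ j → ∑ (pairVectors t d) (λ as → f ((suc i ∷ suc j ∷ []) ∷ as))))
∑-pairVectors-suc t d f = trans (∑-cartesianProductWith _∷_ (vectors X 2) (pairVectors t d) f)
  (trans (∑-cartesianProductWith _∷_ X (vectors X 1) g)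
  (trans (∑-applyUpTo suc t _)
  (Σ<-cong t (λ i → trans (∑-cartesianProductWith _∷_ X ([] ∷ []) (g ∘ (suc i ∷_)))
  (trans (∑-applyUpTo suc t _) (Σ<-cong t (λ j → +-identityʳ _)))))))
  where
  X : List ℕ
  X = applyUpTo suc t
  g : Vec ℕ 2 → ℕ
  g a = ∑ (pairVectors t d) (λ as → f (a ∷ as))

data Used (t : ℕ) : List ℕ → Set where
  []  : Used t []
  _∷_ : ∀ {i U} → i < t × suc i ∉ U → Used t U → Used t (suc i ∷ U)

Σ<-𝟙≟ : ∀ {t j} → j < t → Σ< t (λ i → 𝟙 (i ≟ j)) ≡ 1
Σ<-𝟙≟ {suc t} {zero}  _         = cong suc (trans (Σ<-const t 0) (*-zeroʳ t))
Σ<-𝟙≟ {suc t} {suc j} (s≤s j<t) = trans (Σ<-cong t (λ i → 𝟙-cong (suc i ≟ suc j) (i ≟ j) suc-injective (cong suc))) (Σ<-𝟙≟ j<t)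

Σ<-fresh : ∀ {t U} → Used t U → Σ< t (λ i → 𝟙 (fresh? (suc i) U)) ≡ t ∸ length U
Σ<-fresh {t} {U} used = trans (sym (m+n∸n≡m _ (length U))) (cong (_∸ length U) (count used))
  where
  split : ∀ {x U} → x ∉ U → ∀ y → 𝟙 (fresh? y U) ≡ 𝟙 (fresh? y (x ∷ U)) + 𝟙 (y ≟ x)
  split {x} {U} x∉U y with y ≟ x | mem? _≟_ y U
  ... | yes refl | yes x∈U = ⊥-elim (x∉U x∈U)
  ... | yes refl | no  _   = refl
  ... | no  _    | yes _   = refl
  ... | no  _    | no  _   = refl
  count : ∀ {U} → Used t U → Σ< t (λ i → 𝟙 (fresh? (suc i) U)) + length U ≡ t
  count []                           = trans (+-identityʳ _) (trans (Σ<-const t 1) (*-identityʳ t))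
  count (_∷_ {j} {U} (j<t , x∉U) us) = begin
    A + suc (length U)                   ≡⟨ +-suc A (length U) ⟩
    suc A + length U                     ≡⟨ cong (_+ length U) (+-comm 1 A) ⟩
    A + 1 + length U                     ≡⟨ cong (λ z → A + z + length U) (Σ<-𝟙≟ j<t) ⟨
    A + Σ< t (λ i → 𝟙 (i ≟ j)) + length U ≡⟨ cong (_+ length U) (Σ<-distrib-+ t _ (λ i → 𝟙 (i ≟ j))) ⟨
    Σ< t (λ i → 𝟙 (fresh? (suc i) (suc j ∷ U)) + 𝟙 (i ≟ j)) + length U
      ≡⟨ cong (_+ length U) (Σ<-cong t (λ i → trans (split x∉U (suc i))
           (cong (𝟙 (fresh? (suc i) (suc j ∷ U)) +_) (𝟙-cong (suc i ≟ suc j) (i ≟ j) suc-injective (cong suc))))) ⟨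
    Σ< t (λ i → 𝟙 (fresh? (suc i) U)) + length U ≡⟨ count us ⟩
    t                                    ∎
    where
    open ≡-Reasoning
    A : ℕ
    A = Σ< t (λ i → 𝟙 (fresh? (suc i) (suc j ∷ U)))

-- The number of ways to choose n disjoint ordered pairs when u elements of {1,…,t} are used.
choices : (t n u : ℕ) → ℕ
choices t zero    u = 1
choices t (suc n) u = (t ∸ u) * ((t ∸ suc u) * choices t n (2 + u))

-- Drawing the pairs one after the other, the weight Ψ of the state at most
-- doubles on average in each draw.
module Sampling (t B : ℕ) {σ : Set} (step : ℕ → ℕ → σ → σ) (Ψ : σ → ℕ) (Ok : ℕ → σ → Set)
  (Ok-step : ∀ {n s i j} → i < t → j < t → Ok (suc n) s → Ok n (step (suc i) (suc j) s))
  (Ψ-step : ∀ {n s i U} → i < t → Ok (suc n) s → length U + 2 * suc n ≤ B →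
     Used t (suc i ∷ U) →
     Σ< t (λ j → 𝟙 (fresh? (suc j) (suc i ∷ U)) * Ψ (step (suc i) (suc j) s)) ≤ (t ∸ suc (length U)) * (2 * Ψ s))
  where

  run : ∀ {n} → σ → Pairs n → σ
  run s []                    = s
  run s ((a₁ ∷ a₂ ∷ []) ∷ as) = run (step a₁ a₂ s) as


  private
    unfoldSum : ∀ n U (f : Pairs (suc n) → ℕ) →
      ∑ (pairVectors t (suc n)) (λ as → fresh U (concat as) * f as) ≡
      Σ< t (λ i → 𝟙 (fresh? (suc i) U) * Σ< t (λ j → 𝟙 (fresh? (suc j) (suc i ∷ U)) *
        ∑ (pairVectors t n) (λ as → fresh (suc j ∷ suc i ∷ U) (concat as) * f ((suc i ∷ suc j ∷ []) ∷ as))))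
    unfoldSum n U f = trans (∑-pairVectors-suc t n _) (Σ<-cong t (λ i →
      trans (Σ<-cong t (λ j →
        trans (∑-cong (pairVectors t n) (λ as → lemma (𝟙 (fresh? (suc i) U)) (𝟙 (fresh? (suc j) (suc i ∷ U))) (fresh (suc j ∷ suc i ∷ U) (concat as)) (f ((suc i ∷ suc j ∷ []) ∷ as))))
        (trans (sym (*-distribˡ-∑ (pairVectors t n) (𝟙 (fresh? (suc i) U)) _))
               (cong (𝟙 (fresh? (suc i) U) *_) (sym (*-distribˡ-∑ (pairVectors t n) (𝟙 (fresh? (suc j) (suc i ∷ U))) _))))))
      (sym (*-distribˡ-Σ< t (𝟙 (fresh? (suc i) U)) _))))
      where
      lemma : ∀ a b c d → a * (b * c) * d ≡ a * (b * (c * d))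
      lemma = solve-∀

    Σ<-fresh-* : ∀ {U} → Used t U → ∀ c → Σ< t (λ i → 𝟙 (fresh? (suc i) U) * c) ≡ (t ∸ length U) * c
    Σ<-fresh-* {U} used c = trans (Σ<-cong t (λ i → *-comm (𝟙 (fresh? (suc i) U)) c))
      (trans (sym (*-distribˡ-Σ< t c _)) (trans (cong (c *_) (Σ<-fresh used)) (*-comm c _)))

  choices≤ : ∀ n {U} → Used t U → choices t n (length U) ≤ ∑ (pairVectors t n) (λ as → fresh U (concat as) * 1)
  choices≤ zero        used = ≤-refl
  choices≤ (suc n) {U} used = begin
    (t ∸ length U) * c
      ≡⟨ Σ<-fresh-* used c ⟨
    Σ< t (λ i → 𝟙 (fresh? (suc i) U) * c)
      ≤⟨ Σ<-mono-≤ t (λ i i<t → 𝟙-mono (fresh? (suc i) U) (λ i∉U → inner i i<t i∉U)) ⟩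
    Σ< t (λ i → 𝟙 (fresh? (suc i) U) * Σ< t (λ j → 𝟙 (fresh? (suc j) (suc i ∷ U)) *
        ∑ (pairVectors t n) (λ as → fresh (suc j ∷ suc i ∷ U) (concat as) * 1)))
      ≡⟨ unfoldSum n U (λ _ → 1) ⟨
    ∑ (pairVectors t (suc n)) (λ as → fresh U (concat as) * 1)
      ∎
    where
    open ≤-Reasoning
    c : ℕ
    c = (t ∸ suc (length U)) * choices t n (2 + length U)
    inner : ∀ i → i < t → suc i ∉ U → c ≤ Σ< t (λ j → 𝟙 (fresh? (suc j) (suc i ∷ U)) *
              ∑ (pairVectors t n) (λ as → fresh (suc j ∷ suc i ∷ U) (concat as) * 1))
    inner i i<t i∉U = begin
      c ≡⟨ Σ<-fresh-* used′ (choices t n (2 + length U)) ⟨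
      Σ< t (λ j → 𝟙 (fresh? (suc j) (suc i ∷ U)) * choices t n (2 + length U))
        ≤⟨ Σ<-mono-≤ t (λ j j<t → 𝟙-mono (fresh? (suc j) (suc i ∷ U)) (λ j∉ → choices≤ n ((j<t , j∉) ∷ used′))) ⟩
      Σ< t (λ j → 𝟙 (fresh? (suc j) (suc i ∷ U)) * ∑ (pairVectors t n) (λ as → fresh (suc j ∷ suc i ∷ U) (concat as) * 1)) ∎
      where
      used′ : Used t (suc i ∷ U)
      used′ = (i<t , i∉U) ∷ used

  -- The exponential moment: over `n` further draws the average weight grows by at most `2 ^ n`,
  -- whatever the past. Taking for `f` a scaled indicator below the final weight turns this into
  -- Markov's inequality.
  weight≤ : ∀ n {U s} (f : Pairs n → ℕ) → Used t U → Ok n s → length U + 2 * n ≤ B → (∀ as → Ok 0 (run s as) → f as ≤ Ψ (run s as)) →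
            ∑ (pairVectors t n) (λ as → fresh U (concat as) * f as) ≤ choices t n (length U) * (2 ^ n * Ψ s)
  weight≤ zero    {U} {s} f used ok le f≤ = +-monoˡ-≤ 0 (*-monoʳ-≤ 1 (f≤ [] ok))
  weight≤ (suc n) {U} {s} f used ok le f≤ = begin
    ∑ (pairVectors t (suc n)) (λ as → fresh U (concat as) * f as)
      ≡⟨ unfoldSum n U f ⟩
    Σ< t (λ i → 𝟙 (fresh? (suc i) U) * Σ< t (λ j → 𝟙 (fresh? (suc j) (suc i ∷ U)) *
        ∑ (pairVectors t n) (λ as → fresh (suc j ∷ suc i ∷ U) (concat as) * f ((suc i ∷ suc j ∷ []) ∷ as))))
      ≤⟨ Σ<-mono-≤ t (λ i i<t → 𝟙-mono (fresh? (suc i) U) (λ i∉U → inner i i<t i∉U)) ⟩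
    Σ< t (λ i → 𝟙 (fresh? (suc i) U) * (c * 2 ^ n * ((t ∸ suc u) * (2 * Ψ s))))
      ≡⟨ Σ<-fresh-* used _ ⟩
    (t ∸ u) * (c * 2 ^ n * ((t ∸ suc u) * (2 * Ψ s)))
      ≡⟨ lemma₁ (t ∸ u) (t ∸ suc u) c (2 ^ n) (Ψ s) ⟩
    choices t (suc n) u * (2 ^ suc n * Ψ s)
      ∎
    where
    open ≤-Reasoning
    u c : ℕ
    u = length U
    c = choices t n (2 + u)
    lemma₁ : ∀ a b c p x → a * (c * p * (b * (2 * x))) ≡ a * (b * c) * (2 * p * x)
    lemma₁ = solve-∀
    lemma₂ : ∀ a b p x → a * (b * (p * x)) ≡ b * p * (a * x)
    lemma₂ = solve-∀
    le′ : 2 + u + 2 * n ≤ B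
    le′ = subst (_≤ B) (lemma₃ u n) le
      where
      lemma₃ : ∀ u n → u + 2 * suc n ≡ 2 + u + 2 * n
      lemma₃ = solve-∀
    inner : ∀ i → i < t → suc i ∉ U → Σ< t (λ j → 𝟙 (fresh? (suc j) (suc i ∷ U)) *
              ∑ (pairVectors t n) (λ as → fresh (suc j ∷ suc i ∷ U) (concat as) * f ((suc i ∷ suc j ∷ []) ∷ as)))
              ≤ c * 2 ^ n * ((t ∸ suc u) * (2 * Ψ s))
    inner i i<t i∉U = begin
      Σ< t (λ j → 𝟙 (fresh? (suc j) (suc i ∷ U)) *
              ∑ (pairVectors t n) (λ as → fresh (suc j ∷ suc i ∷ U) (concat as) * f ((suc i ∷ suc j ∷ []) ∷ as)))
        ≤⟨ Σ<-mono-≤ t (λ j j<t → 𝟙-mono (fresh? (suc j) (suc i ∷ U)) (λ j∉ →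
             weight≤ n (λ as → f ((suc i ∷ suc j ∷ []) ∷ as)) ((j<t , j∉) ∷ used′) (Ok-step i<t j<t ok) le′ (λ as → f≤ ((suc i ∷ suc j ∷ []) ∷ as)))) ⟩
      Σ< t (λ j → 𝟙 (fresh? (suc j) (suc i ∷ U)) * (c * (2 ^ n * Ψ (step (suc i) (suc j) s))))
        ≡⟨ Σ<-cong t (λ j → lemma₂ (𝟙 (fresh? (suc j) (suc i ∷ U))) c (2 ^ n) (Ψ (step (suc i) (suc j) s))) ⟩
      Σ< t (λ j → c * 2 ^ n * (𝟙 (fresh? (suc j) (suc i ∷ U)) * Ψ (step (suc i) (suc j) s)))
        ≡⟨ *-distribˡ-Σ< t (c * 2 ^ n) _ ⟨
      c * 2 ^ n * Σ< t (λ j → 𝟙 (fresh? (suc j) (suc i ∷ U)) * Ψ (step (suc i) (suc j) s))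
        ≤⟨ *-monoʳ-≤ (c * 2 ^ n) (Ψ-step i<t ok le used′) ⟩
      c * 2 ^ n * ((t ∸ suc u) * (2 * Ψ s))
        ∎
      where
      used′ : Used t (suc i ∷ U)
      used′ = (i<t , i∉U) ∷ used

-- Two alternating partial sums

-- `i ∸ j` runs down from `i` to 0 and stays there; `g 0 ≡ 0` cancels the repetitions.
Σ<-∸-≤ : ∀ n i g → g 0 ≡ 0 → Σ< n (λ j → g (i ∸ j)) ≤ Σ< (suc i) g
Σ<-∸-≤ n zero g g0 = ≤-trans (≤-reflexive (trans (Σ<-cong n (λ j → trans (cong g (0∸n≡0 j)) g0)) (trans (Σ<-const n 0) (*-zeroʳ n)))) z≤n
Σ<-∸-≤ zero    (suc i) g g0 = z≤n
Σ<-∸-≤ (suc n) (suc i) g g0 = begin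
  g (suc i) + Σ< n (λ j → g (i ∸ j)) ≤⟨ +-monoʳ-≤ (g (suc i)) (Σ<-∸-≤ n i g g0) ⟩
  g (suc i) + Σ< (suc i) g           ≡⟨ +-comm (g (suc i)) _ ⟩
  Σ< (suc i) g + g (suc i)           ≡⟨ Σ<-snoc (suc i) g ⟨
  Σ< (2 + i) g                       ∎
  where open ≤-Reasoning

-- The next pair goes to the first node, and the nodes are swapped.
module Alternating (t d A r₁ : ℕ) .{{_ : NonZero A}} (4d≤t : 4 * d ≤ t) (3ʳt≤4ʳ : 3 ^ r₁ * t ≤ 4 ^ r₁) where

  -- In `q = 4 * A`, one factor 2 pays for the two partners at a given distance, the other for the
  -- elements already used. `W` has room for every partial sum, at most `d * t`, translated by up to
  -- the largest `multiplier` times `t`.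
  q W : ℕ
  q = 4 * A
  W = suc (d * t) + suc (2 * q * 4 ^ d) * t

  instance
    q≢0 : NonZero q
    q≢0 = m*n≢0 4 A

  open Energy W
  open Process t q W r₁ 3ʳt≤4ʳ

  State : Set
  State = Node × Node

  step : ℕ → ℕ → State → State
  step a₁ a₂ (N , N′) = N′ , extend a₁ a₂ N

  Ψ : State → ℕ
  Ψ (N , N′) = A ^ (bad N + bad N′)

  -- `n` pairs are still to be drawn; the node next in turn is level with the other or one pair
  -- behind.
  record Ok (n : ℕ) (s : State) : Set where
    field
      inv       : Inv (proj₁ s)
      inv′      : Inv (proj₂ s)
      total     : steps (proj₁ s) + steps (proj₂ s) + n ≡ d
      balanced  : steps (proj₁ s) ≤ steps (proj₂ s)
      balanced′ : steps (proj₂ s) ≤ suc (steps (proj₁ s))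

  Ok-step : ∀ {n s i j} → i < t → j < t → Ok (suc n) s → Ok n (step (suc i) (suc j) s)
  Ok-step {n} {N , N′} {i} {j} i<t j<t ok = record
    { inv       = Ok.inv′ ok
    ; inv′      = Inv-extend i<t j<t (Ok.inv ok)
    ; total     = trans (cong (λ k → steps N′ + k + n) k≡) (trans (lemma (steps N′) (steps N) n) (Ok.total ok))
    ; balanced  = subst (steps N′ ≤_) (sym k≡) (Ok.balanced′ ok)
    ; balanced′ = subst (_≤ suc (steps N′)) (sym k≡) (s≤s (Ok.balanced ok))
    }
    where
    k≡ : steps (extend (suc i) (suc j) N) ≡ suc (steps N)
    k≡ = steps-extend (suc i) (suc j) N
    lemma : ∀ a b n → a + suc b + n ≡ b + a + suc n
    lemma = solve-∀

  -- Only `i + b` and `i - b` lie at distance `b` from `i`, so bad partners are at most twice as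
  -- many as bad shifts; freshness excludes distance 0.
  few-bad-partners : ∀ {N} U i → i < t → Inv N → steps N ≤ d →
    4 * A * Σ< t (λ j → 𝟙 (fresh? (suc j) (suc i ∷ U)) * 𝟙 (badPair? N (suc i) (suc j))) ≤ 2 * t
  few-bad-partners {N} U i i<t inv k≤d = begin
    q * Σ< t (λ j → 𝟙 (fresh? (suc j) (suc i ∷ U)) * χ ∣ i - j ∣)
      ≤⟨ *-monoʳ-≤ q (Σ<-mono-≤ t (λ j _ → pointwise j)) ⟩
    q * Σ< t (λ j → shift i β j + β (i ∸ j))
      ≡⟨ cong (q *_) (Σ<-distrib-+ t (shift i β) (λ j → β (i ∸ j))) ⟩
    q * (Σ< t (shift i β) + Σ< t (λ j → β (i ∸ j)))
      ≤⟨ *-monoʳ-≤ q (+-mono-≤ (≤-trans (Σ<-shift-≤ i t β) (Σ<-monoˡ-≤ β (n≤1+n t)))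
                               (≤-trans (Σ<-∸-≤ t i β refl) (Σ<-monoˡ-≤ β (s≤s (<⇒≤ i<t))))) ⟩
    q * (L + L)
      ≡⟨ *-distribˡ-+ q L L ⟩
    q * L + q * L
      ≤⟨ +-mono-≤ qL≤t qL≤t ⟩
    t + t
      ≡⟨ cong (t +_) (+-identityʳ t) ⟨
    2 * t
      ∎
    where
    open ≤-Reasoning
    χ β : ℕ → ℕ
    χ b = 𝟙 (bad? (multiplier N) (F N) b)
    β zero    = 0
    β (suc b) = χ (suc b)
    L : ℕ
    L = Σ< t (χ ∘ suc)
    qL≤t : q * L ≤ t
    qL≤t = few-bad-shifts inv (+-mono-≤ (s≤s (*-monoˡ-≤ t k≤d))
      (*-monoˡ-≤ t (≤-trans (multiplier≤ N) (s≤s (*-monoʳ-≤ (2 * q) (^-monoʳ-≤ 4 k≤d))))))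
    apart : ∀ i j → i ≢ j → χ ∣ i - j ∣ ≤ shift i β j + β (i ∸ j)
    apart zero    zero    i≢j = ⊥-elim (i≢j refl)
    apart zero    (suc j) i≢j = m≤m+n (χ (suc j)) _
    apart (suc i) zero    i≢j = ≤-refl
    apart (suc i) (suc j) i≢j = apart i j (i≢j ∘ cong suc)
    pointwise : ∀ j → 𝟙 (fresh? (suc j) (suc i ∷ U)) * χ ∣ i - j ∣ ≤ shift i β j + β (i ∸ j)
    pointwise j with fresh? (suc j) (suc i ∷ U)
    ... | no  _  = z≤n
    ... | yes j∉ = ≤-trans (≤-reflexive (+-identityʳ _)) (apart i j (λ i≡j → j∉ (here (cong suc (sym i≡j)))))

  -- A bad pair multiplies the weight `p` by `A`, but at most `v / A` of the `v` fresh partners are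
  -- bad, so the total is at most `p (v + A (v / A)) = 2 p v`.
  Ψ-step : ∀ {n s i U} → i < t → Ok (suc n) s → length U + 2 * suc n ≤ 2 * d → Used t (suc i ∷ U) →
    Σ< t (λ j → 𝟙 (fresh? (suc j) (suc i ∷ U)) * Ψ (step (suc i) (suc j) s)) ≤ (t ∸ suc (length U)) * (2 * Ψ s)
  Ψ-step {n} {N , N′} {i} {U} i<t ok le used = begin
    Σ< t (λ j → φ j * Ψ (step (suc i) (suc j) (N , N′)))
      ≤⟨ Σ<-mono-≤ t (λ j _ → pointwise j) ⟩
    Σ< t (λ j → p * (φ j + A * (φ j * χ j)))
      ≡⟨ *-distribˡ-Σ< t p _ ⟨
    p * Σ< t (λ j → φ j + A * (φ j * χ j))
      ≡⟨ cong (p *_) (Σ<-distrib-+ t φ _) ⟩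
    p * (Σ< t φ + Σ< t (λ j → A * (φ j * χ j)))
      ≡⟨ cong₂ (λ y z → p * (y + z)) (Σ<-fresh used) (sym (*-distribˡ-Σ< t A _)) ⟩
    p * (v + A * Σ< t (λ j → φ j * χ j))
      ≤⟨ *-monoʳ-≤ p (+-monoʳ-≤ v (*-cancelˡ-≤ 4 4AL≤4v)) ⟩
    p * (v + v)
      ≡⟨ lemma₁ p v ⟩
    v * (2 * p)
      ∎
    where
    open ≤-Reasoning
    φ χ : ℕ → ℕ
    φ j = 𝟙 (fresh? (suc j) (suc i ∷ U))
    χ j = 𝟙 (badPair? N (suc i) (suc j))
    p v u : ℕ
    p = Ψ (N , N′)
    u = length U
    v = t ∸ suc u
    lemma₁ : ∀ p v → p * (v + v) ≡ v * (2 * p)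
    lemma₁ = solve-∀
    lemma₂ : ∀ u n → suc u + suc (2 * n) ≡ u + 2 * suc n
    lemma₂ = solve-∀
    lemma₃ : ∀ a f p → a * p * f ≡ p * (0 + a * (f * 1))
    lemma₃ = solve-∀
    -- At most half of the elements are used up, hence `v ≥ t / 2`.
    2[1+u]≤t : 2 * suc u ≤ t
    2[1+u]≤t = begin
      2 * suc u     ≤⟨ *-monoʳ-≤ 2 (m+n≤o⇒m≤o (suc u) (≤-trans (≤-reflexive (lemma₂ u n)) le)) ⟩
      2 * (2 * d)   ≡⟨ *-assoc 2 2 d ⟨
      4 * d         ≤⟨ 4d≤t ⟩
      t             ∎
    t≤2v : t ≤ 2 * v
    t≤2v = begin
      t                        ≤⟨ m+n≤o⇒m≤o∸n t (+-monoʳ-≤ t (≤-trans 2[1+u]≤t (≤-reflexive (sym (+-identityʳ t))))) ⟩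
      2 * t ∸ 2 * suc u        ≡⟨ *-distribˡ-∸ 2 t (suc u) ⟨
      2 * v                    ∎
    4AL≤4v : 4 * (A * Σ< t (λ j → φ j * χ j)) ≤ 4 * v
    4AL≤4v = begin
      4 * (A * Σ< t (λ j → φ j * χ j)) ≡⟨ *-assoc 4 A _ ⟨
      4 * A * Σ< t (λ j → φ j * χ j)   ≤⟨ few-bad-partners U i i<t (Ok.inv ok) k≤d ⟩
      2 * t                            ≤⟨ *-monoʳ-≤ 2 t≤2v ⟩
      2 * (2 * v)                      ≡⟨ *-assoc 2 2 v ⟨
      4 * v                            ∎
      where
      k≤d : steps N ≤ d
      k≤d = m+n≤o⇒m≤o (steps N) (m+n≤o⇒m≤o (steps N + steps N′) (≤-reflexive (Ok.total ok)))
    pointwise : ∀ j → φ j * Ψ (step (suc i) (suc j) (N , N′)) ≤ p * (φ j + A * (φ j * χ j))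
    pointwise j with badPair? N (suc i) (suc j)
    ... | no  _ = begin
      φ j * A ^ (bad N′ + bad N)        ≡⟨ cong (λ k → φ j * A ^ k) (+-comm (bad N′) (bad N)) ⟩
      φ j * p                           ≡⟨ *-comm (φ j) p ⟩
      p * φ j                           ≤⟨ *-monoʳ-≤ p (m≤m+n (φ j) _) ⟩
      p * (φ j + A * (φ j * 0))         ∎
    ... | yes _ = begin
      φ j * A ^ (bad N′ + suc (bad N))  ≡⟨ cong (λ k → φ j * A ^ k) (+-comm (bad N′) (suc (bad N))) ⟩
      φ j * (A * p)                     ≡⟨ *-comm (φ j) (A * p) ⟩
      A * p * φ j                       ≡⟨ lemma₃ A (φ j) p ⟩
      p * (0 + A * (φ j * 1))           ≤⟨ *-monoʳ-≤ p (+-monoˡ-≤ (A * (φ j * 1)) z≤n) ⟩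
      p * (φ j + A * (φ j * 1))         ∎

  open Sampling t (2 * d) step Ψ Ok Ok-step Ψ-step public

  initial : State
  initial = root , root

  Ok-initial : Ok d initial
  Ok-initial = record { inv = Inv-root ; inv′ = Inv-root ; total = refl ; balanced = z≤n ; balanced′ = z≤n }

  -- Each draw turns the two translates of one node into the two values of one index, and
  -- commutativity of `conv` takes care of the swap. Started at two roots, `conv` at `S` counts the
  -- index choices with `Q = S`.
  conv-run : ∀ {n} (as : Pairs n) N N′ S → let (M , M′) = run (N , N′) as in
    conv (F M) (F M′) S ≡ ∑ (indexChoices n) (λ js → shift (Q as js) (conv (F N) (F N′)) S)
  conv-run []                                N N′ S = sym (+-identityʳ _)
  conv-run {suc n} ((a₁ ∷ a₂ ∷ []) ∷ as) N N′ S = begin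
    conv (F M) (F M′) S
      ≡⟨ conv-run as N′ (extend a₁ a₂ N) S ⟩
    ∑ J (λ js → shift (Q as js) (conv (F N′) (addPair a₁ a₂ (F N))) S)
      ≡⟨ ∑-cong J (λ js → shift-cong (Q as js) (λ x →
           trans (conv-comm (F N′) (addPair a₁ a₂ (F N)) x) (conv-addPairˡ a₁ a₂ (F N) (F N′) x)) S) ⟩
    ∑ J (λ js → shift (Q as js) (addPair a₁ a₂ P) S)
      ≡⟨ ∑-cong J (λ js → trans (shift-zipWith _+_ refl (Q as js) (shift a₁ P) (shift a₂ P) S)
           (cong₂ _+_ (swap (Q as js) a₁) (swap (Q as js) a₂))) ⟩
    ∑ J (λ js → shift (a₁ + Q as js) P S + shift (a₂ + Q as js) P S)
      ≡⟨ ∑-distrib-+ J _ _ ⟩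
    ∑ J (λ js → shift (a₁ + Q as js) P S) + ∑ J (λ js → shift (a₂ + Q as js) P S)
      ≡⟨ cong (∑ J (λ js → shift (a₁ + Q as js) P S) +_) (+-identityʳ _) ⟨
    ∑ J (λ js → shift (a₁ + Q as js) P S) + (∑ J (λ js → shift (a₂ + Q as js) P S) + 0)
      ≡⟨ ∑-cartesianProductWith _∷_ (List.allFin 2) J _ ⟨
    ∑ (indexChoices (suc n)) (λ js → shift (Q ((a₁ ∷ a₂ ∷ []) ∷ as) js) P S)
      ∎
    where
    open ≡-Reasoning
    M M′ : Node
    M = proj₁ (run (N , N′) ((a₁ ∷ a₂ ∷ []) ∷ as))
    M′ = proj₂ (run (N , N′) ((a₁ ∷ a₂ ∷ []) ∷ as))
    J : List (Vec (Fin 2) n)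
    J = indexChoices n
    P : ℕ → ℕ
    P = conv (F N) (F N′)
    swap : ∀ b a → shift b (shift a P) S ≡ shift (a + b) P S
    swap b a = trans (shift-shift b a P S) (cong (λ c → shift c P S) (+-comm b a))

  -- Weighted Cauchy-Schwarz. The energies are at most `8 q * 4 ^ k / (t √m)` and
  -- `8 q * 4 ^ k′ / (t √m)` with `k + k′ = d`, so the weights `2 ^ k′` and `2 ^ k` bring both terms
  -- to the same bound `8 q * 4 ^ d / √m`.
  conv-flat : ∀ {s} m → Ok 0 s → m + r₁ ≤ good (proj₁ s) → m + r₁ ≤ good (proj₂ s) →
              ∀ S → sq (conv (F (proj₁ s)) (F (proj₂ s)) S * t) * m ≤ sq (8 * q * 2 ^ d)
  conv-flat {N , N′} m ok g g′ S = *-cancelˡ-≤ (4 * sq P) {{4P²≢0}} (begin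
    4 * sq P * (sq (c * t) * m)              ≡⟨ lemma₁ P c t m ⟩
    sq (2 * P * c * t) * m                   ≤⟨ *-monoˡ-≤ m (*-mono-≤ 2Pct≤ 2Pct≤) ⟩
    sq (x + y) * m                           ≤⟨ *-monoˡ-≤ m sq-+ ⟩
    2 * (sq x + sq y) * m                    ≡⟨ lemma₂ (sq x) (sq y) m ⟩
    2 * (sq x * m + sq y * m)                ≤⟨ *-monoʳ-≤ 2 (+-mono-≤ x²m≤ y²m≤) ⟩
    2 * (sq z + sq z)                        ≡⟨ lemma₃ q P ⟩
    4 * sq P * sq (8 * q * P)                ∎)
    where
    open ≤-Reasoning
    k k′ P α β c x y z : ℕ
    k = steps N
    k′ = steps N′
    P = 2 ^ d
    α = 2 ^ k′
    β = 2 ^ k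
    c = conv (F N) (F N′) S
    x = sq α * (E (F N) * t)
    y = sq β * (E (F N′) * t)
    z = 8 * q * sq P
    k+k′≡d : k + k′ ≡ d
    k+k′≡d = trans (sym (+-identityʳ (k + k′))) (Ok.total ok)
    αβ≡P : α * β ≡ P
    αβ≡P = trans (sym (^-distribˡ-+-* 2 k′ k)) (cong (2 ^_) (trans (+-comm k′ k) k+k′≡d))
    4P²≢0 : NonZero (4 * sq P)
    4P²≢0 = m*n≢0 4 (sq P) {{_}} {{m*n≢0 P P {{m^n≢0 2 d}} {{m^n≢0 2 d}}}}
    lemma₁ : ∀ P c t m → 4 * (P * P) * (c * t * (c * t) * m) ≡ 2 * P * c * t * (2 * P * c * t) * m
    lemma₁ = solve-∀
    lemma₂ : ∀ x y m → 2 * (x + y) * m ≡ 2 * (x * m + y * m)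
    lemma₂ = solve-∀
    lemma₃ : ∀ q P → 2 * (8 * q * (P * P) * (8 * q * (P * P)) + 8 * q * (P * P) * (8 * q * (P * P))) ≡ 4 * (P * P) * (8 * q * P * (8 * q * P))
    lemma₃ = solve-∀
    lemma₄ : ∀ x y → (x + y) * (x + y) ≡ x * x + y * y + 2 * (x * y)
    lemma₄ = solve-∀
    lemma₅ : ∀ a e b f t → (a * e + b * f) * t ≡ a * (e * t) + b * (f * t)
    lemma₅ = solve-∀
    lemma₆ : ∀ a w m → a * w * (a * w) * m ≡ a * a * (w * w * m)
    lemma₆ = solve-∀
    lemma₇ : ∀ a b q → a * a * (a * a) * (8 * q * (b * b) * (8 * q * (b * b))) ≡ 8 * q * (a * b * (a * b)) * (8 * q * (a * b * (a * b)))
    lemma₇ = solve-∀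
    sq-+ : sq (x + y) ≤ 2 * (sq x + sq y)
    sq-+ = begin
      sq (x + y)                       ≡⟨ lemma₄ x y ⟩
      sq x + sq y + 2 * (x * y)        ≤⟨ +-monoʳ-≤ (sq x + sq y) (2mn≤m²+n² x y) ⟩
      sq x + sq y + (sq x + sq y)      ≡⟨ cong (sq x + sq y +_) (+-identityʳ (sq x + sq y)) ⟨
      2 * (sq x + sq y)                ∎
    Σ≤E : ∀ {M} → Inv M → steps M ≤ d → Σ< (suc S) (sq ∘ F M) ≤ E (F M)
    Σ≤E {M} inv k≤d = ≤-trans (Σ<-supported (suc S) (sq ∘ F M) (λ x le → cong sq (Inv.supported inv x le)))
      (Σ<-monoˡ-≤ (sq ∘ F M) (≤-trans (s≤s (*-monoˡ-≤ t k≤d)) (m≤m+n (suc (d * t)) _)))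
    2Pct≤ : 2 * P * c * t ≤ x + y
    2Pct≤ = begin
      2 * P * c * t                          ≡⟨ cong (λ z → 2 * z * c * t) αβ≡P ⟨
      2 * (α * β) * c * t                    ≤⟨ *-monoˡ-≤ t (conv-AM-GM α β (F N) (F N′) S) ⟩
      (sq α * Σ< (suc S) (sq ∘ F N) + sq β * Σ< (suc S) (sq ∘ F N′)) * t
        ≤⟨ *-monoˡ-≤ t (+-mono-≤ (*-monoʳ-≤ (sq α) (Σ≤E (Ok.inv ok) (m+n≤o⇒m≤o k (≤-reflexive k+k′≡d))))
                                 (*-monoʳ-≤ (sq β) (Σ≤E (Ok.inv′ ok) (m+n≤o⇒n≤o k (≤-reflexive k+k′≡d))))) ⟩
      (sq α * E (F N) + sq β * E (F N′)) * t ≡⟨ lemma₅ (sq α) (E (F N)) (sq β) (E (F N′)) t ⟩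
      x + y                                  ∎
    scaled : ∀ {M} → Inv M → m + r₁ ≤ good M → ∀ a → a * 2 ^ steps M ≡ P → sq (sq a * (E (F M) * t)) * m ≤ sq z
    scaled {M} inv g a ab≡P = begin
      sq (sq a * (E (F M) * t)) * m             ≡⟨ lemma₆ (sq a) (E (F M) * t) m ⟩
      sq (sq a) * (sq (E (F M) * t) * m)        ≤⟨ *-monoʳ-≤ (sq (sq a)) (energy-small inv m g) ⟩
      sq (sq a) * sq (8 * q * 4 ^ steps M)      ≡⟨ cong (λ w → sq (sq a) * sq (8 * q * w)) (4^n≡sq[2^n] (steps M)) ⟩
      sq (sq a) * sq (8 * q * sq b)             ≡⟨ lemma₇ a b q ⟩
      sq (8 * q * sq (a * b))                   ≡⟨ cong (λ w → sq (8 * q * sq w)) ab≡P ⟩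
      sq z                                      ∎
      where
      b : ℕ
      b = 2 ^ steps M
    x²m≤ : sq x * m ≤ sq z
    x²m≤ = scaled (Ok.inv ok) g α αβ≡P
    y²m≤ : sq y * m ≤ sq z
    y²m≤ = scaled (Ok.inv′ ok) g′ β (trans (*-comm β α) αβ≡P)

-- Fractions and probabilities

open import Data.Integer.Base as ℤ using (+_; -[1+_]; +≤+)
import Data.Integer.Properties as ℤ
open import Data.Rational.Base as ℚ using (ℚ; 0ℚ; 1ℚ; toℚᵘ)
import Data.Rational.Properties as ℚ
open import Data.Rational.Unnormalised.Base as ℚᵘ using (mkℚᵘ; *≤*)
import Data.Rational.Unnormalised.Properties as ℚᵘ

/-* : ∀ a b m n .{{_ : NonZero m}} .{{_ : NonZero n}} .{{_ : NonZero (m * n)}} →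
      (+ a ℚ./ m) ℚ.* (+ b ℚ./ n) ≡ + (a * b) ℚ./ (m * n)
/-* a b (suc m) (suc n) = ℚ.toℚᵘ-injective (begin-equality
  toℚᵘ ((+ a ℚ./ suc m) ℚ.* (+ b ℚ./ suc n))         ≃⟨ ℚ.toℚᵘ-homo-* (+ a ℚ./ suc m) (+ b ℚ./ suc n) ⟩
  toℚᵘ (+ a ℚ./ suc m) ℚᵘ.* toℚᵘ (+ b ℚ./ suc n)     ≃⟨ ℚᵘ.*-cong (ℚ.toℚᵘ-fromℚᵘ (mkℚᵘ (+ a) m)) (ℚ.toℚᵘ-fromℚᵘ (mkℚᵘ (+ b) n)) ⟩
  mkℚᵘ (+ a) m ℚᵘ.* mkℚᵘ (+ b) n                     ≡⟨ cong (λ z → mkℚᵘ z (n + m * suc n)) (ℤ.pos-* a b) ⟨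
  mkℚᵘ (+ (a * b)) (n + m * suc n)                   ≃⟨ ℚ.toℚᵘ-fromℚᵘ (mkℚᵘ (+ (a * b)) (n + m * suc n)) ⟨
  toℚᵘ (+ (a * b) ℚ./ (suc m * suc n))               ∎)
  where open ℚᵘ.≤-Reasoning

/-+ : ∀ a b m n .{{_ : NonZero m}} .{{_ : NonZero n}} .{{_ : NonZero (m * n)}} →
      (+ a ℚ./ m) ℚ.+ (+ b ℚ./ n) ≡ + (a * n + b * m) ℚ./ (m * n)
/-+ a b (suc m) (suc n) = ℚ.toℚᵘ-injective (begin-equality
  toℚᵘ ((+ a ℚ./ suc m) ℚ.+ (+ b ℚ./ suc n))         ≃⟨ ℚ.toℚᵘ-homo-+ (+ a ℚ./ suc m) (+ b ℚ./ suc n) ⟩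
  toℚᵘ (+ a ℚ./ suc m) ℚᵘ.+ toℚᵘ (+ b ℚ./ suc n)     ≃⟨ ℚᵘ.+-cong (ℚ.toℚᵘ-fromℚᵘ (mkℚᵘ (+ a) m)) (ℚ.toℚᵘ-fromℚᵘ (mkℚᵘ (+ b) n)) ⟩
  mkℚᵘ (+ a) m ℚᵘ.+ mkℚᵘ (+ b) n                     ≡⟨ cong (λ z → mkℚᵘ z (n + m * suc n)) (cong₂ ℤ._+_ (ℤ.pos-* a (suc n)) (ℤ.pos-* b (suc m))) ⟨
  mkℚᵘ (+ (a * suc n + b * suc m)) (n + m * suc n)   ≃⟨ ℚ.toℚᵘ-fromℚᵘ (mkℚᵘ (+ (a * suc n + b * suc m)) (n + m * suc n)) ⟨
  toℚᵘ (+ (a * suc n + b * suc m) ℚ./ (suc m * suc n)) ∎)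
  where open ℚᵘ.≤-Reasoning

/-mono-≤ : ∀ a b m n .{{_ : NonZero m}} .{{_ : NonZero n}} → a * n ≤ b * m → + a ℚ./ m ℚ.≤ + b ℚ./ n
/-mono-≤ a b (suc m) (suc n) le = ℚ.toℚᵘ-cancel-≤ (begin
  toℚᵘ (+ a ℚ./ suc m)  ≃⟨ ℚ.toℚᵘ-fromℚᵘ (mkℚᵘ (+ a) m) ⟩
  mkℚᵘ (+ a) m          ≤⟨ *≤* (subst₂ ℤ._≤_ (ℤ.pos-* a (suc n)) (ℤ.pos-* b (suc m)) (+≤+ le)) ⟩
  mkℚᵘ (+ b) n          ≃⟨ ℚ.toℚᵘ-fromℚᵘ (mkℚᵘ (+ b) n) ⟨
  toℚᵘ (+ b ℚ./ suc n)  ∎)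
  where open ℚᵘ.≤-Reasoning

Pr≡ : ∀ {a p} {A : Set a} {P : Pred A p} (Ω : List A) (P? : Decidable P) .{{_ : NonZero (length Ω)}} →
      Pr Ω P? ≡ + length (filter P? Ω) ℚ./ length Ω
Pr≡ (_ ∷ _) P? = refl

length-filter≡∑ : ∀ {a p} {A : Set a} {P : Pred A p} (P? : Decidable P) xs → length (filter P? xs) ≡ ∑ xs (λ x → 𝟙 (P? x))
length-filter≡∑ P? xs = trans (length≡∑ (filter P? xs)) (trans (∑-filter P? xs _) (∑-cong xs (λ x → *-identityʳ (𝟙 (P? x)))))

≤/√-intro : ∀ n L c t d .{{_ : NonZero L}} → sq (n * t) * d ≤ sq (c * L) → (+ n ℚ./ L) ≤ (+ c ℚ./ 1) /[ t √ d ]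
≤/√-intro n L c t d le = subst₂ ℚ._≤_ (sym lhs) (sym rhs) (/-mono-≤ (sq (n * t) * d) (sq c) (sq (L * 1) * 1) 1 (begin
  sq (n * t) * d * 1    ≡⟨ *-identityʳ (sq (n * t) * d) ⟩
  sq (n * t) * d        ≤⟨ le ⟩
  sq (c * L)            ≡⟨ lemma c L ⟩
  sq c * (sq (L * 1) * 1) ∎))
  where
  open ≤-Reasoning
  lemma : ∀ c L → c * L * (c * L) ≡ c * c * (L * 1 * (L * 1) * 1)
  lemma = solve-∀
  instance
    L1≢0 : NonZero (L * 1)
    L1≢0 = m*n≢0 L 1
    den₂ : NonZero (sq (L * 1))
    den₂ = m*n≢0 (L * 1) (L * 1)
    den : NonZero (sq (L * 1) * 1)
    den = m*n≢0 (sq (L * 1)) 1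
  xt : (+ n ℚ./ L) ℚ.* (+ t ℚ./ 1) ≡ (+ (n * t) ℚ./ (L * 1))
  xt = /-* n t L 1
  lhs : (+ n ℚ./ L) ℚ.* (+ t ℚ./ 1) ℚ.* ((+ n ℚ./ L) ℚ.* (+ t ℚ./ 1)) ℚ.* (+ d ℚ./ 1) ≡ (+ (sq (n * t) * d) ℚ./ (sq (L * 1) * 1))
  lhs = trans (cong (ℚ._* (+ d ℚ./ 1)) (trans (cong₂ ℚ._*_ xt xt) (/-* (n * t) (n * t) (L * 1) (L * 1))))
    (/-* (sq (n * t)) d (sq (L * 1)) 1)
  rhs : (+ c ℚ./ 1) ℚ.* (+ c ℚ./ 1) ≡ + sq c ℚ./ 1
  rhs = /-* c c 1 1

1-1/t²≤ : ∀ t g n .{{_ : NonZero t}} .{{_ : NonZero n}} → n * sq t ≤ g * sq t + n →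
          1ℚ ℚ.- (+ 1 ℚ./ t) ℚ.* (+ 1 ℚ./ t) ℚ.≤ + g ℚ./ n
1-1/t²≤ t g n le = begin
  1ℚ ℚ.- r            ≤⟨ ℚ.+-monoˡ-≤ (ℚ.- r) 1≤ ⟩
  x ℚ.+ r ℚ.- r       ≡⟨ ℚ.+-assoc x r (ℚ.- r) ⟩
  x ℚ.+ (r ℚ.- r)     ≡⟨ cong (x ℚ.+_) (ℚ.+-inverseʳ r) ⟩
  x ℚ.+ 0ℚ            ≡⟨ ℚ.+-identityʳ x ⟩
  x                   ∎
  where
  open ℚ.≤-Reasoning
  r x : ℚ
  r = (+ 1 ℚ./ t) ℚ.* (+ 1 ℚ./ t)
  x = + g ℚ./ n
  instance
    t²≢0 : NonZero (sq t)
    t²≢0 = m*n≢0 t t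
    den : NonZero (n * sq t)
    den = m*n≢0 n (sq t)
  x+r≡ : x ℚ.+ r ≡ (+ (g * sq t + 1 * n) ℚ./ (n * sq t))
  x+r≡ = trans (cong (x ℚ.+_) (/-* 1 1 t t)) (/-+ g 1 n (sq t))
  1≤ : 1ℚ ℚ.≤ x ℚ.+ r
  1≤ = subst (1ℚ ℚ.≤_) (sym x+r≡) (/-mono-≤ 1 (g * sq t + 1 * n) 1 (n * sq t)
    (subst₂ _≤_ (sym (+-identityʳ (n * sq t))) (sym (trans (*-identityʳ (g * sq t + 1 * n)) (cong (λ z → g * sq t + z) (+-identityʳ n)))) le))

-- The choice of parameters

n<2^[1+⌊log₂n⌋] : ∀ n → n < 2 ^ suc ⌊log₂ n ⌋
n<2^[1+⌊log₂n⌋] n = ≰⇒> λ le →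
  1+n≰n (subst (_≤ ⌊log₂ n ⌋) (⌊log₂[2^n]⌋≡n (suc ⌊log₂ n ⌋)) (⌊log₂⌋-mono-≤ le))

2^-cancel-< : ∀ {m n} → 2 ^ m < 2 ^ n → m < n
2^-cancel-< lt = ≰⇒> λ n≤m → <⇒≱ lt (^-monoʳ-≤ 2 n≤m)

-- Three good steps at least halve the normalised energy, as `2 * 27 ≤ 64`.
3^[3n]*2^n≤4^[3n] : ∀ n → 3 ^ (3 * n) * 2 ^ n ≤ 4 ^ (3 * n)
3^[3n]*2^n≤4^[3n] n = subst₂ (λ x y → x * 2 ^ n ≤ y) (^-*-assoc 3 3 n) (^-*-assoc 4 3 n) (go n)
  where
  lemma : ∀ x y → 27 * x * (2 * y) ≡ 54 * (x * y)
  lemma = solve-∀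
  go : ∀ n → 27 ^ n * 2 ^ n ≤ 64 ^ n
  go zero    = ≤-refl
  go (suc n) = ≤-trans (≤-reflexive (lemma (27 ^ n) (2 ^ n))) (*-mono-≤ (m≤m+n 54 10) (go n))

length-indexChoices : ∀ d → length (indexChoices d) ≡ 2 ^ d
length-indexChoices zero    = refl
length-indexChoices (suc d) = trans (length≡∑ (indexChoices (suc d)))
  (trans (∑-cartesianProductWith _∷_ (List.allFin 2) (indexChoices d) (λ _ → 1))
  (cong (λ z → z + (z + 0)) (trans (sym (length≡∑ (indexChoices d))) (length-indexChoices d))))

shift-δ₀ : ∀ s x → shift s δ₀ x ≡ 𝟙 (+ s ℤ.≟ + x)
shift-δ₀ zero    zero    = refl
shift-δ₀ zero    (suc x) = refl
shift-δ₀ (suc s) zero    = refl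
shift-δ₀ (suc s) (suc x) = trans (shift-δ₀ s x)
  (𝟙-cong (+ s ℤ.≟ + x) (+ suc s ℤ.≟ + suc x) (cong (ℤ._+_ (+ 1))) (λ eq → cong +_ (suc-injective (ℤ.+-injective eq))))

choices-pos : ∀ t n u → u + 2 * n ≤ t → 0 < choices t n u
choices-pos t zero    u le = s≤s z≤n
choices-pos t (suc n) u le = *-mono-< {0} {t ∸ u} (m<n⇒0<n∸m (m+n≤o⇒m≤o (suc u) le′))
  (*-mono-< {0} {t ∸ suc u} (m<n⇒0<n∸m (m+n≤o⇒m≤o (2 + u) le″)) (choices-pos t n (2 + u) le″))
  where
  lemma₁ : ∀ u n → u + 2 * suc n ≡ suc u + suc (2 * n)
  lemma₁ = solve-∀
  lemma₂ : ∀ u n → u + 2 * suc n ≡ 2 + u + 2 * n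
  lemma₂ = solve-∀
  le′ : suc u + suc (2 * n) ≤ t
  le′ = subst (_≤ t) (lemma₁ u n) le
  le″ : 2 + u + 2 * n ≤ t
  le″ = subst (_≤ t) (lemma₂ u n) le

𝟙≤1 : ∀ {P : Set} (P? : Dec P) → 𝟙 P? ≤ 1
𝟙≤1 (yes _) = ≤-refl
𝟙≤1 (no _)  = z≤n

𝟙-¬?-holds : ∀ {P : Set} (P? : Dec P) → P → 𝟙 (¬? P?) ≡ 0
𝟙-¬?-holds (yes _) p = refl
𝟙-¬?-holds (no ¬p) p = ⊥-elim (¬p p)

𝟙+𝟙-¬? : ∀ {P : Set} (P? : Dec P) → 𝟙 P? + 𝟙 (¬? P?) ≡ 1
𝟙+𝟙-¬? (yes _) = refl
𝟙+𝟙-¬? (no _)  = refl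

-- With ℓ ≈ d / 16: t ≤ 2^ℓ bounds the 3ℓ good steps spent while t N is large,
-- at most ℓ bad pairs leave 4ℓ further good ones in each half, and A ≥ 2^34
-- makes A^ℓ beat 2^d t² ≤ 2^(34 ℓ).
module Main (c a : ℕ) (32≤c : 32 ≤ c) (34≤a : 34 ≤ a) (t d : ℕ) .{{_ : NonZero t}} .{{_ : NonZero d}}
  (30d≤t : 30 * d ≤ t) (tᶜ<2^[1+d] : t ^ c < 2 ^ suc d) where

  A ℓ : ℕ
  A = 2 ^ a
  ℓ = d ℕ./ 16

  instance
    A≢0 : NonZero A
    A≢0 = m^n≢0 2 a

  2≤t : 2 ≤ t
  2≤t = ≤-trans (m≤m+n 2 28) (≤-trans (m≤m*n 30 d) 30d≤t)

  -- As `t ≥ 2`, the logarithmic lower bound excludes small `d`, and with it `ℓ = 0`.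
  32≤d : 32 ≤ d
  32≤d = ≤-trans 32≤c (≤-pred (2^-cancel-< (≤-<-trans (^-monoˡ-≤ c 2≤t) tᶜ<2^[1+d])))

  16ℓ≤d : 16 * ℓ ≤ d
  16ℓ≤d = subst (_≤ d) (*-comm ℓ 16) (m/n*n≤m d 16)

  d<16+16ℓ : d < 16 + 16 * ℓ
  d<16+16ℓ = begin-strict
    d                          ≡⟨ m≡m%n+[m/n]*n d 16 ⟩
    d ℕ.% 16 + ℓ * 16          <⟨ +-monoˡ-< (ℓ * 16) (m%n<n d 16) ⟩
    16 + ℓ * 16                ≡⟨ cong (λ z → 16 + z) (*-comm ℓ 16) ⟩
    16 + 16 * ℓ                ∎
    where open ≤-Reasoning

  1≤ℓ : 1 ≤ ℓ
  1≤ℓ = <⇒≤ (*-cancelˡ-< 16 1 ℓ (+-cancelˡ-< 16 16 (16 * ℓ) (≤-<-trans 32≤d d<16+16ℓ)))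

  1+d≤32ℓ : suc d ≤ 32 * ℓ
  1+d≤32ℓ = begin
    suc d             ≤⟨ d<16+16ℓ ⟩
    16 + 16 * ℓ       ≤⟨ +-monoˡ-≤ (16 * ℓ) (*-monoʳ-≤ 16 1≤ℓ) ⟩
    16 * ℓ + 16 * ℓ   ≡⟨ *-distribʳ-+ ℓ 16 16 ⟨
    32 * ℓ            ∎
    where open ≤-Reasoning

  -- The logarithmic lower bound on `d` is spent here: `t > 2 ^ ℓ` would give
  -- `t ^ c ≥ 2 ^ (32 * ℓ) ≥ 2 ^ suc d`.
  t≤2^ℓ : t ≤ 2 ^ ℓ
  t≤2^ℓ with ≤-<-connex t (2 ^ ℓ)
  ... | inj₁ le = le
  ... | inj₂ lt = ⊥-elim (<⇒≱ tᶜ<2^[1+d] (begin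
    2 ^ suc d       ≤⟨ ^-monoʳ-≤ 2 1+d≤32ℓ ⟩
    2 ^ (32 * ℓ)    ≤⟨ ^-monoʳ-≤ 2 (*-monoˡ-≤ ℓ 32≤c) ⟩
    2 ^ (c * ℓ)     ≡⟨ cong (2 ^_) (*-comm c ℓ) ⟩
    2 ^ (ℓ * c)     ≡⟨ ^-*-assoc 2 ℓ c ⟨
    (2 ^ ℓ) ^ c     ≤⟨ ^-monoˡ-≤ c (<⇒≤ lt) ⟩
    t ^ c           ∎))
    where open ≤-Reasoning

  4d≤t : 4 * d ≤ t
  4d≤t = ≤-trans (*-monoˡ-≤ d (m≤m+n 4 26)) 30d≤t

  2d≤t : 2 * d ≤ t
  2d≤t = ≤-trans (*-monoˡ-≤ d (m≤m+n 2 28)) 30d≤t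

  open Alternating t d A (3 * ℓ) 4d≤t
    (≤-trans (*-monoʳ-≤ (3 ^ (3 * ℓ)) t≤2^ℓ) (3^[3n]*2^n≤4^[3n] ℓ))

  -- Passing from `4 * ℓ` in `conv-flat` to `d ≤ 32 * ℓ` costs a factor 8; rounded up to the square
  -- 9, it gives `24 = 3 * 8`.
  C : ℕ
  C = 24 * q

  enough-good : ∀ N k → 8 * ℓ ≤ k → steps N ≡ k → bad N ≤ ℓ → 4 * ℓ + 3 * ℓ ≤ good N
  enough-good N k 8ℓ≤k refl bad≤ = +-cancelʳ-≤ ℓ (4 * ℓ + 3 * ℓ) (good N) (begin
    4 * ℓ + 3 * ℓ + ℓ   ≡⟨ lemma ℓ ⟩
    8 * ℓ               ≤⟨ 8ℓ≤k ⟩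
    good N + bad N      ≤⟨ +-monoʳ-≤ (good N) bad≤ ⟩
    good N + ℓ          ∎)
    where
    open ≤-Reasoning
    lemma : ∀ ℓ → 4 * ℓ + 3 * ℓ + ℓ ≡ 8 * ℓ
    lemma = solve-∀

  few-bad⇒spread : ∀ as → Ok 0 (run initial as) → let (N , N′) = run initial as in
                   bad N + bad N′ ≤ ℓ → Spread (+ C ℚ./ 1) t as
  few-bad⇒spread as ok few S = subst (λ x → x ≤ (+ C ℚ./ 1) /[ t √ d ]) (sym (Pr≡ (indexChoices d) P?))
    (≤/√-intro (length (filter P? (indexChoices d))) (length (indexChoices d)) C t d
      (subst (λ L → sq (length (filter P? (indexChoices d)) * t) * d ≤ sq (C * L)) (sym (length-indexChoices d)) (bound S)))
    where
    open ≤-Reasoning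
    instance
      len≢0 : NonZero (length (indexChoices d))
      len≢0 = subst NonZero (sym (length-indexChoices d)) (m^n≢0 2 d)
    P? : Decidable (λ js → + Q as js ≡ S)
    P? js = + Q as js ℤ.≟ S
    N N′ : Node
    N = proj₁ (run initial as)
    N′ = proj₂ (run initial as)
    -- The nodes differ by at most one pair, so `16 * ℓ ≤ d ≤ 2 * steps N + 1`, and integrality
    -- removes the 1.
    k≥ : 8 * ℓ ≤ steps N
    k≥ = ≤-pred (*-cancelˡ-< 2 (8 * ℓ) (suc (steps N)) (begin-strict
      2 * (8 * ℓ)                 ≡⟨ *-assoc 2 8 ℓ ⟨
      16 * ℓ                      ≤⟨ 16ℓ≤d ⟩
      d                           ≡⟨ Ok.total ok ⟨
      steps N + steps N′ + 0      ≡⟨ +-identityʳ (steps N + steps N′) ⟩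
      steps N + steps N′          ≤⟨ +-monoʳ-≤ (steps N) (Ok.balanced′ ok) ⟩
      steps N + suc (steps N)     <⟨ ≤-refl ⟩
      suc (steps N) + suc (steps N) ≡⟨ cong (λ z → suc (steps N) + z) (+-identityʳ (suc (steps N))) ⟨
      2 * suc (steps N)           ∎))
    flat : ∀ n → sq (conv (F N) (F N′) n * t) * (4 * ℓ) ≤ sq (8 * q * 2 ^ d)
    flat = conv-flat (4 * ℓ) ok (enough-good N (steps N) k≥ refl (m+n≤o⇒m≤o (bad N) few))
      (enough-good N′ (steps N′) (≤-trans k≥ (Ok.balanced ok)) refl (m+n≤o⇒n≤o (bad N) few))
    count : ∀ n → length (filter (λ js → + Q as js ℤ.≟ + n) (indexChoices d)) ≡ conv (F N) (F N′) n
    count n = trans (length-filter≡∑ (λ js → + Q as js ℤ.≟ + n) (indexChoices d)) (sym (trans (conv-run as root root n)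
      (∑-cong (indexChoices d) (λ js → trans (shift-cong (Q as js) conv-δ₀ n) (shift-δ₀ (Q as js) n)))))
    lemma₁ : ∀ ℓ → 32 * ℓ ≡ 4 * ℓ * 8
    lemma₁ = solve-∀
    lemma₂ : ∀ q P → 8 * q * P * (8 * q * P) * 9 ≡ 24 * q * P * (24 * q * P)
    lemma₂ = solve-∀
    bound : ∀ S → sq (length (filter (λ js → + Q as js ℤ.≟ S) (indexChoices d)) * t) * d ≤ sq (C * 2 ^ d)
    bound (+ n)    = begin
      sq (length (filter (λ js → + Q as js ℤ.≟ + n) (indexChoices d)) * t) * d ≡⟨ cong (λ c → sq (c * t) * d) (count n) ⟩
      x * d                    ≤⟨ *-monoʳ-≤ x (<⇒≤ 1+d≤32ℓ) ⟩
      x * (32 * ℓ)             ≡⟨ cong (x *_) (lemma₁ ℓ) ⟩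
      x * (4 * ℓ * 8)          ≡⟨ *-assoc x (4 * ℓ) 8 ⟨
      x * (4 * ℓ) * 8          ≤⟨ *-mono-≤ (flat n) (n≤1+n 8) ⟩
      sq (8 * q * 2 ^ d) * 9   ≡⟨ lemma₂ q (2 ^ d) ⟩
      sq (C * 2 ^ d)           ∎
      where
      x : ℕ
      x = sq (conv (F N) (F N′) n * t)
    -- `Q` takes no negative value, so the count is 0.
    bound -[1+ n ] = subst (λ c → sq (c * t) * d ≤ sq (C * 2 ^ d))
      (sym (cong length (filter-none (λ js → + Q as js ℤ.≟ -[1+ n ]) (ListAll.universal (λ js ()) (indexChoices d))))) z≤n

  Ω : List (Pairs d)
  Ω = pairChoices t d

  good? : Decidable (Spread (+ C ℚ./ 1) t {d})
  good? = spread? (+ C ℚ./ 1) t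

  fails : ℕ
  fails = ∑ Ω (λ as → 𝟙 (¬? (good? as)))

  choices≤Ω : choices t d 0 ≤ length Ω
  choices≤Ω = ≤-trans (choices≤ d []) (≤-reflexive (trans (sym (∑-pairChoices t d (λ _ → 1))) (sym (length≡∑ Ω))))

  2^d*t²≤A^ℓ : 2 ^ d * sq t ≤ A ^ ℓ
  2^d*t²≤A^ℓ = begin
    2 ^ d * sq t                    ≤⟨ *-mono-≤ (^-monoʳ-≤ 2 (<⇒≤ 1+d≤32ℓ)) (*-mono-≤ t≤2^ℓ t≤2^ℓ) ⟩
    2 ^ (32 * ℓ) * (2 ^ ℓ * 2 ^ ℓ)  ≡⟨ cong (2 ^ (32 * ℓ) *_) (^-distribˡ-+-* 2 ℓ ℓ) ⟨
    2 ^ (32 * ℓ) * 2 ^ (ℓ + ℓ)      ≡⟨ ^-distribˡ-+-* 2 (32 * ℓ) (ℓ + ℓ) ⟨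
    2 ^ (32 * ℓ + (ℓ + ℓ))          ≡⟨ cong (2 ^_) (lemma ℓ) ⟩
    2 ^ (34 * ℓ)                    ≤⟨ ^-monoʳ-≤ 2 (*-monoˡ-≤ ℓ 34≤a) ⟩
    2 ^ (a * ℓ)                     ≡⟨ ^-*-assoc 2 a ℓ ⟨
    A ^ ℓ                           ∎
    where
    open ≤-Reasoning
    lemma : ∀ ℓ → 32 * ℓ + (ℓ + ℓ) ≡ 34 * ℓ
    lemma = solve-∀

  -- Markov's inequality for `Ψ`: by `few-bad⇒spread` a failing choice has more than `ℓ` bad pairs
  -- and thus weight at least `A ^ ℓ`, while the initial weight is 1.
  fails*A^ℓ≤ : A ^ ℓ * fails ≤ length Ω * 2 ^ d
  fails*A^ℓ≤ = begin
    A ^ ℓ * fails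
      ≡⟨ *-distribˡ-∑ Ω (A ^ ℓ) _ ⟩
    ∑ Ω f
      ≡⟨ ∑-pairChoices t d f ⟩
    ∑ (pairVectors t d) (λ as → fresh [] (concat as) * f as)
      ≤⟨ weight≤ d f [] Ok-initial ≤-refl f≤Ψ ⟩
    choices t d 0 * (2 ^ d * 1)
      ≤⟨ *-mono-≤ choices≤Ω (≤-reflexive (*-identityʳ (2 ^ d))) ⟩
    length Ω * 2 ^ d
      ∎
    where
    open ≤-Reasoning
    f : Pairs d → ℕ
    f as = A ^ ℓ * 𝟙 (¬? (good? as))
    f≤Ψ : ∀ as → Ok 0 (run initial as) → f as ≤ Ψ (run initial as)
    f≤Ψ as ok = [ few , many ]′ (≤-<-connex (bad (proj₁ (run initial as)) + bad (proj₂ (run initial as))) ℓ)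
      where
      few : bad (proj₁ (run initial as)) + bad (proj₂ (run initial as)) ≤ ℓ → f as ≤ Ψ (run initial as)
      few le = ≤-trans (≤-reflexive (trans (cong (A ^ ℓ *_) (𝟙-¬?-holds (good? as) (few-bad⇒spread as ok le))) (*-zeroʳ (A ^ ℓ)))) z≤n
      many : ℓ < bad (proj₁ (run initial as)) + bad (proj₂ (run initial as)) → f as ≤ Ψ (run initial as)
      many lt = ≤-trans (*-monoʳ-≤ (A ^ ℓ) (𝟙≤1 (¬? (good? as))))
                  (≤-trans (≤-reflexive (*-identityʳ (A ^ ℓ))) (^-monoʳ-≤ A (<⇒≤ lt)))

  fails*t²≤ : fails * sq t ≤ length Ω
  fails*t²≤ = *-cancelˡ-≤ (2 ^ d) {{m^n≢0 2 d}} (begin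
    2 ^ d * (fails * sq t)     ≡⟨ lemma (2 ^ d) fails (sq t) ⟩
    2 ^ d * sq t * fails       ≤⟨ *-monoˡ-≤ fails 2^d*t²≤A^ℓ ⟩
    A ^ ℓ * fails              ≤⟨ fails*A^ℓ≤ ⟩
    length Ω * 2 ^ d           ≡⟨ *-comm (length Ω) (2 ^ d) ⟩
    2 ^ d * length Ω           ∎)
    where
    open ≤-Reasoning
    lemma : ∀ a b c → a * (b * c) ≡ a * c * b
    lemma = solve-∀

  length-Ω : length Ω ≡ length (filter good? Ω) + fails
  length-Ω = trans (length≡∑ Ω) (trans (∑-cong Ω (λ as → sym (𝟙+𝟙-¬? (good? as))))
    (trans (∑-distrib-+ Ω (λ as → 𝟙 (good? as)) _) (cong (_+ fails) (sym (length-filter≡∑ good? Ω)))))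

  spread-whp : 1ℚ ℚ.- (+ 1 ℚ./ t) ℚ.* (+ 1 ℚ./ t) ℚ.≤ Pr Ω good?
  spread-whp = subst (1ℚ ℚ.- (+ 1 ℚ./ t) ℚ.* (+ 1 ℚ./ t) ℚ.≤_) (sym (Pr≡ Ω good?))
    (1-1/t²≤ t (length (filter good? Ω)) (length Ω) (begin
      length Ω * sq t                                     ≡⟨ cong (_* sq t) length-Ω ⟩
      (length (filter good? Ω) + fails) * sq t            ≡⟨ *-distribʳ-+ (sq t) (length (filter good? Ω)) fails ⟩
      length (filter good? Ω) * sq t + fails * sq t       ≤⟨ +-monoʳ-≤ (length (filter good? Ω) * sq t) fails*t²≤ ⟩
      length (filter good? Ω) * sq t + length Ω           ∎))
    where
    open ≤-Reasoning
    instance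
      Ω≢0 : NonZero (length Ω)
      Ω≢0 = >-nonZero (≤-trans (choices-pos t d 0 2d≤t) choices≤Ω)

lemma2p3 : ∃[ C₁ ] ∃[ C₂ ] 0ℚ ℚ.< C₁ × 0ℚ ℚ.< C₂ ×
    ((t d : ℕ) .{{_ : NonZero t}} .{{_ : NonZero d}} →
    30 ℕ.* d ℕ.≤ t → ⌊ C₁ ·log₂ t ⌋ ℕ.≤ d →
    1ℚ ℚ.- (+ 1 ℚ./ t) ℚ.* (+ 1 ℚ./ t) ℚ.≤ Pr (pairChoices t d) (spread? C₂ t))
lemma2p3 = + 32 ℚ./ 1 , + (24 * (4 * 2 ^ 34)) ℚ./ 1 , ℚ.positive⁻¹ (+ 32 ℚ./ 1) , ℚ.positive⁻¹ (+ (24 * (4 * 2 ^ 34)) ℚ./ 1) ,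
  -- The second witness is `C`, with `q = 4 * A` and `A = 2 ^ 34`. Rounding the logarithm down costs
  -- a factor 2, hence `t ^ 32 < 2 ^ suc d`.
  λ t d 30d≤t log≤d → Main.spread-whp 32 34 ≤-refl ≤-refl t d 30d≤t
    (<-≤-trans (n<2^[1+⌊log₂n⌋] (t ^ 32))
      (^-monoʳ-≤ 2 (s≤s (subst (_≤ d) (n/1≡n ⌊log₂ t ^ 32 ⌋) log≤d))))
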